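{- Let $F:\mathbb R^N\to\mathbb R^N$ be continuously differentiable and $K\subseteq\mathbb R^N$. Let $X=\mathbb R^N\times\mathbb R^N\times[0,\infty)$ and define $\Gamma_K:\mathcal P(X)\to\mathcal P(X)$ by $$\Gamma_K(Z)=\{(x,y,t)\in G_K: x,y\in K,\ \exists u\ \big((x,u,\tfrac t2)\in Z\ \text{and}\ (u,y,\tfrac t2)\in Z\big)\}.$$ The map $\Gamma_K$ is monotone. For compact $K$, the set $\mathcal R_K$ is the greatest fixpoint of $\Gamma_K$.
   Context: $|\cdot|$ is the norm on $\mathbb R^N$ and $\|H\|_K=\sup_{x\in K}|H(x)|$ for $H:\mathbb R^N\to\mathbb R^N$. $DF$ is the Jacobian matrix of $F$ and $(DF)F$ is the map $x\mapsto DF(x)F(x)$. A continuous $\gamma:[a,b]\to\mathbb R^N$ is an integral curve of $F$ if it is differentiable on $(a,b)$ with $\gamma'(s)=F(\gamma(s))$ for all $s\in(a,b)$. $\mathcal R_K$ is the set of $(x,y,t)\in X$ such that there is an integral curve $\gamma:[0,t]\to\mathbb R^N$ of $F$ with $\gamma(0)=x$, $\gamma(t)=y$ and $\gamma(s)\in K$ for all $s\in[0,t]$. $G_K=\{(x,y,t)\in X: |y-x|\le t\|F\|_K\ \text{and}\ |y-x-tF(x)|\le\tfrac{t^2}{2}\|(DF)F\|_K\}$. $\Gamma_K$ monotone means $A\subseteq B$ implies $\Gamma_K(A)\subseteq\Gamma_K(B)$. -}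

module Defs where

open import Algebra.Bundles using (CommutativeRing)
open import Algebra.Structures using (IsCommutativeRing)
import Algebra.Properties.Ring as RingProperties
open import Axiom.ExcludedMiddle using (ExcludedMiddle)
open import Data.Fin.Base using (Fin)
open import Data.List.Base using (List)
open import Data.List.Relation.Unary.Any using (Any)
open import Data.Nat.Base using (ℕ)
open import Data.Product.Base using (Σ; ∃; _×_; _,_; proj₁; proj₂)
open import Data.Refinement.Base using (Refinement-syntax; value; map)
open import Data.Sum.Base using (inj₁; inj₂)
open import Data.Unit.Base using (⊤)
open import Data.Vec.Base as Vec using (Vec; lookup)
open import Level using (0ℓ)
open import Relation.Binary.PropositionalEquality using (_≡_; _≢_; sym; trans; cong; subst; subst₂)
open import Relation.Binary.Structures using (IsTotalOrder)
import Relation.Binary.Construct.NonStrictToStrict as ToStrict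
open import Relation.Nullary.Decidable.Core using (yes; no)
open import Relation.Unary using (Pred; _∈_; _⊆_; _≐_; Satisfiable)

-- The real numbers, up to isomorphism.  Equality is _≡_, so that arbitrary
-- functions and subsets respect it.

record CompleteOrderedField : Set₁ where
  infix  4 _≤_
  infixl 6 _+_
  infixl 7 _*_
  infix  8 -_
  field
    ℝ   : Set
    _+_ : ℝ → ℝ → ℝ
    _*_ : ℝ → ℝ → ℝ
    -_  : ℝ → ℝ
    0#  : ℝ
    1#  : ℝ
    _≤_ : ℝ → ℝ → Set

    isCommutativeRing : IsCommutativeRing _≡_ _+_ _*_ -_ 0# 1#
    0≢1               : 0# ≢ 1#
    inverse           : ∀ x → x ≢ 0# → ∃ λ y → x * y ≡ 1#

    isTotalOrder      : IsTotalOrder _≡_ _≤_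
    +-monoˡ-≤         : ∀ z {x y} → x ≤ y → x + z ≤ y + z
    *-nonneg          : ∀ {x y} → 0# ≤ x → 0# ≤ y → 0# ≤ x * y

  UpperBound : Pred ℝ 0ℓ → Pred ℝ 0ℓ
  UpperBound S b = ∀ x → x ∈ S → x ≤ b

  IsSupremum : Pred ℝ 0ℓ → Pred ℝ 0ℓ
  IsSupremum S s = s ∈ UpperBound S × (∀ b → b ∈ UpperBound S → s ≤ b)

  field
    complete : (S : Pred ℝ 0ℓ) → Satisfiable S → Satisfiable (UpperBound S) →
               Satisfiable (IsSupremum S)

  open ToStrict _≡_ _≤_ public using (_<_)

module Analysis (em : ExcludedMiddle 0ℓ) (𝓕 : CompleteOrderedField) where

  open CompleteOrderedField 𝓕 public

  private
    commutativeRing : CommutativeRing 0ℓ 0ℓ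
    commutativeRing = record { isCommutativeRing = isCommutativeRing }

    module R = CommutativeRing commutativeRing
    module RP = RingProperties R.ring
    module O = IsTotalOrder isTotalOrder

  infixl 6 _-_
  _-_ : ℝ → ℝ → ℝ
  x - y = x + (- y)

  abs : ℝ → ℝ
  abs x with O.total 0# x
  ... | inj₁ _ = x
  ... | inj₂ _ = - x

  0≤1 : 0# ≤ 1#
  0≤1 with O.total 0# 1#
  ... | inj₁ 0≤1 = 0≤1
  ... | inj₂ 1≤0 = subst (0# ≤_) -1*-1≡1 (*-nonneg 0≤-1 0≤-1)
    where
    0≤-1 : 0# ≤ - 1#
    0≤-1 = subst₂ _≤_ (R.-‿inverseʳ 1#) (R.+-identityˡ (- 1#)) (+-monoˡ-≤ (- 1#) 1≤0)

    -1*-1≡1 : (- 1#) * (- 1#) ≡ 1#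
    -1*-1≡1 = trans (RP.-1*x≈-x (- 1#)) (RP.-‿involutive 1#)

  2# : ℝ
  2# = 1# + 1#

  1≤2 : 1# ≤ 2#
  1≤2 = subst (_≤ 2#) (R.+-identityˡ 1#) (+-monoˡ-≤ 1# 0≤1)

  2≢0 : 2# ≢ 0#
  2≢0 2≡0 = 0≢1 (O.antisym 0≤1 (subst (1# ≤_) 2≡0 1≤2))

  ½ : ℝ
  ½ = proj₁ (inverse 2# 2≢0)

  0≤½ : 0# ≤ ½
  0≤½ with O.total 0# ½
  ... | inj₁ 0≤½ = 0≤½
  ... | inj₂ ½≤0 = subst (_≤ ½) 1≡0 (subst (_≤ ½) 2½≡1 2½≤½)
    where
    2½≡1 : 2# * ½ ≡ 1#
    2½≡1 = proj₂ (inverse 2# 2≢0)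

    ½+½≡2½ : ½ + ½ ≡ 2# * ½
    ½+½≡2½ = sym (trans (R.distribʳ ½ 1# 1#)
                        (trans (cong (_+ (1# * ½)) (R.*-identityˡ ½))
                               (cong (½ +_) (R.*-identityˡ ½))))

    2½≤½ : 2# * ½ ≤ ½
    2½≤½ = subst₂ _≤_ ½+½≡2½ (R.+-identityˡ ½) (+-monoˡ-≤ ½ ½≤0)

    1≤0 : 1# ≤ 0#
    1≤0 = O.trans (subst (_≤ ½) 2½≡1 2½≤½) ½≤0

    1≡0 : 1# ≡ 0#
    1≡0 = O.antisym 1≤0 0≤1

  ℝ≥0 : Set
  ℝ≥0 = [ t ∈ ℝ ∣ 0# ≤ t ]

  half : ℝ≥0 → ℝ≥0
  half = map (½ *_) (*-nonneg 0≤½)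

  -- Total by convention: 0# when S is empty or not bounded above.
  sup : Pred ℝ 0ℓ → ℝ
  sup S with em {Satisfiable S × Satisfiable (UpperBound S)}
  ... | yes (nonempty , bounded) = proj₁ (complete S nonempty bounded)
  ... | no  _                    = 0#

  -- For a ≥ 0 the set is nonempty and bounded, so this is the square root.
  √ : ℝ → ℝ
  √ a = sup (λ r → r * r ≤ a)

  infix 9 ℝ^_
  ℝ^_ : ℕ → Set
  ℝ^ N = Vec ℝ N

  infixl 6 _⊕_ _⊖_
  infixr 7 _⊙_

  _⊕_ : ∀ {N} → ℝ^ N → ℝ^ N → ℝ^ N
  _⊕_ = Vec.zipWith _+_

  _⊖_ : ∀ {N} → ℝ^ N → ℝ^ N → ℝ^ N
  _⊖_ = Vec.zipWith _-_

  _⊙_ : ∀ {N} → ℝ → ℝ^ N → ℝ^ N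
  c ⊙ x = Vec.map (c *_) x

  _∙_ : ∀ {N} → ℝ^ N → ℝ^ N → ℝ
  x ∙ y = Vec.foldr′ _+_ 0# (Vec.zipWith _*_ x y)

  ∣_∣ : ∀ {N} → ℝ^ N → ℝ
  ∣ x ∣ = √ (x ∙ x)

  Matrix : ℕ → ℕ → Set
  Matrix M N = Vec (ℝ^ N) M

  _·ᵥ_ : ∀ {M N} → Matrix M N → ℝ^ N → ℝ^ M
  A ·ᵥ x = Vec.map (_∙ x) A

  Continuous : ∀ {M N} → (ℝ^ M → ℝ^ N) → Set
  Continuous f = ∀ x ε → 0# < ε → ∃ λ δ → 0# < δ ×
    (∀ y → ∣ y ⊖ x ∣ < δ → ∣ f y ⊖ f x ∣ < ε)

  HasJacobianAt : ∀ {M N} → (ℝ^ M → ℝ^ N) → ℝ^ M → Matrix N M → Set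
  HasJacobianAt f x A = ∀ ε → 0# < ε → ∃ λ δ → 0# < δ ×
    (∀ h → ∣ h ∣ < δ → ∣ f (x ⊕ h) ⊖ f x ⊖ A ·ᵥ h ∣ ≤ ε * ∣ h ∣)

  record ContinuouslyDifferentiable {M N} (f : ℝ^ M → ℝ^ N) : Set where
    field
      D            : ℝ^ M → Matrix N M
      hasJacobian  : ∀ x → HasJacobianAt f x (D x)
      D-continuous : ∀ (i : Fin N) → Continuous (λ x → lookup (D x) i)

  IsOpen : ∀ {N} → Pred (ℝ^ N) 0ℓ → Set
  IsOpen U = ∀ x → x ∈ U → ∃ λ ε → 0# < ε × (∀ y → ∣ y ⊖ x ∣ < ε → y ∈ U)

  IsCompact : ∀ {N} → Pred (ℝ^ N) 0ℓ → Set₁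
  IsCompact {N} K = (I : Set) (U : I → Pred (ℝ^ N) 0ℓ) → (∀ i → IsOpen (U i)) →
    (∀ x → x ∈ K → ∃ λ i → x ∈ U i) →
    Σ (List I) λ is → ∀ x → x ∈ K → Any (λ i → x ∈ U i) is

  -- Curves on [a,b] are represented by total functions; only the values on
  -- [a,b] matter below.

  ContinuousOn : ∀ {N} → ℝ → ℝ → (ℝ → ℝ^ N) → Set
  ContinuousOn a b γ = ∀ s → a ≤ s → s ≤ b → ∀ ε → 0# < ε → ∃ λ δ → 0# < δ ×
    (∀ r → a ≤ r → r ≤ b → abs (r - s) < δ → ∣ γ r ⊖ γ s ∣ < ε)

  HasDerivativeAt : ∀ {N} → (ℝ → ℝ^ N) → ℝ → ℝ^ N → Set
  HasDerivativeAt γ s v = ∀ ε → 0# < ε → ∃ λ δ → 0# < δ ×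
    (∀ h → abs h < δ → ∣ γ (s + h) ⊖ γ s ⊖ h ⊙ v ∣ ≤ ε * abs h)

  IsIntegralCurve : ∀ {N} → (ℝ^ N → ℝ^ N) → ℝ → ℝ → (ℝ → ℝ^ N) → Set
  IsIntegralCurve F a b γ =
    ContinuousOn a b γ ×
    (∀ s → a < s → s < b → HasDerivativeAt γ s (F (γ s)))

  data ℝ∞ : Set where
    fin : ℝ → ℝ∞
    ∞   : ℝ∞

  infix 4 _≤∞_
  _≤∞_ : ℝ → ℝ∞ → Set
  x ≤∞ fin y = x ≤ y
  x ≤∞ ∞     = ⊤

  -- Used for c ≥ 0 only, with 0 · ∞ = 0.
  _·∞_ : ℝ → ℝ∞ → ℝ∞
  c ·∞ fin y = fin (c * y)
  c ·∞ ∞ with em {c ≡ 0#}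
  ... | yes _ = fin 0#
  ... | no  _ = ∞

  normsOn : ∀ {N} → (ℝ^ N → ℝ^ N) → Pred (ℝ^ N) 0ℓ → Pred ℝ 0ℓ
  normsOn H K r = ∃ λ x → x ∈ K × r ≡ ∣ H x ∣

  -- The supremum is taken in [0,∞]: it is 0 for empty K and ∞ if H is
  -- unbounded on K.
  ‖_‖[_] : ∀ {N} → (ℝ^ N → ℝ^ N) → Pred (ℝ^ N) 0ℓ → ℝ∞
  ‖ H ‖[ K ] with em {Satisfiable (UpperBound (normsOn H K))}
  ... | yes _ = fin (sup (normsOn H K))
  ... | no  _ = ∞

  X : ℕ → Set
  X N = ℝ^ N × ℝ^ N × ℝ≥0

  ℛ[_,_] : ∀ {N} → (ℝ^ N → ℝ^ N) → Pred (ℝ^ N) 0ℓ → Pred (X N) 0ℓ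
  ℛ[ F , K ] (x , y , t) = ∃ λ γ → IsIntegralCurve F 0# (value t) γ ×
    γ 0# ≡ x × γ (value t) ≡ y × (∀ s → 0# ≤ s → s ≤ value t → γ s ∈ K)

  module _ {N} {F : ℝ^ N → ℝ^ N} (C¹ : ContinuouslyDifferentiable F)
           (K : Pred (ℝ^ N) 0ℓ) where

    open ContinuouslyDifferentiable C¹

    G : Pred (X N) 0ℓ
    G (x , y , t) =
      ∣ y ⊖ x ∣ ≤∞ value t ·∞ ‖ F ‖[ K ] ×
      ∣ y ⊖ x ⊖ value t ⊙ F x ∣ ≤∞
        (½ * (value t * value t)) ·∞ ‖ (λ z → D z ·ᵥ F z) ‖[ K ]

    Γ : Pred (X N) 0ℓ → Pred (X N) 0ℓ
    Γ Z (x , y , t) =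
      (x , y , t) ∈ G × x ∈ K × y ∈ K ×
      ∃ λ u → (x , u , half t) ∈ Z × (u , y , half t) ∈ Z

  Monotone : ∀ {A : Set} → (Pred A 0ℓ → Pred A 0ℓ) → Set₁
  Monotone Φ = ∀ {Z Z′} → Z ⊆ Z′ → Φ Z ⊆ Φ Z′

  IsGreatestFixpoint : ∀ {A : Set} → (Pred A 0ℓ → Pred A 0ℓ) → Pred A 0ℓ → Set₁
  IsGreatestFixpoint Φ R = Φ R ≐ R × (∀ Z → Φ Z ≐ Z → Z ⊆ R)

{-# OPTIONS --safe #-}
module Submission where

-- Solutions of γ′ = F ∘ γ are replaced by curves satisfying a mean value
-- inequality: if F ∘ γ stays within ε of v on [s , s′], then
-- |γ s′ - γ s - (s′ - s) v| ≤ (s′ - s) ε.  Such curves restrict and concatenate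
-- without any differentiation at the junction, which gives both halves of
-- Γ ℛ ≐ ℛ once the two bounds defining G are deduced: the first is the case v = 0,
-- the second follows from |F (γ s′) - F (γ s)| ≤ (s′ - s) ‖(DF)F‖ by repeated halving.
-- Conversely, a triple in a post-fixpoint Z can be bisected forever; by the
-- first bound of G the vertices converge to a Lipschitz curve, which stays in
-- the closed set K, and the second bound makes the mean value inequality hold
-- on each dyadic segment of length h up to an error of order h².

open import Algebra.Bundles using (CommutativeRing; RawRing)
import Algebra.Properties.Ring as RingProperties
import Algebra.Properties.Semiring.Mult.TCOptimised as SemiringMult
import Algebra.Solver.Ring as RingSolver
open import Algebra.Solver.Ring.AlmostCommutativeRing using (_-Raw-AlmostCommutative⟶_; fromCommutativeRing)
open import Axiom.ExcludedMiddle using (ExcludedMiddle)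
open import Data.Empty using (⊥-elim)
open import Data.Integer.Base as ℤ using (ℤ; -[1+_]; +[1+_])
import Data.Integer.Properties as ℤ
open import Data.Irrelevant using ([_])
open import Data.List.Base using (List; []; _∷_)
open import Data.List.Relation.Unary.Any using (Any; here; there)
open import Data.Maybe.Base as Maybe using (Maybe)
open import Data.Nat.Base as ℕ using (ℕ; zero; suc)
import Data.Nat.Properties as ℕ
open import Data.Product.Base using (∃; _×_; _,_; proj₁; proj₂)
open import Data.Refinement.Base as Refinement using (value)
open import Data.Sum.Base using (_⊎_; inj₁; inj₂; [_,_]′)
open import Data.Vec.Base as Vec using (Vec; []; _∷_; head; lookup; replicate; tail)
open import Data.Fin.Base using (zero; suc)
open import Level using (0ℓ)
open import Relation.Binary.PropositionalEquality hiding ([_])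
open import Relation.Binary.Structures using (IsTotalOrder)
open import Relation.Nullary using (¬_; yes; no)
open import Relation.Nullary.Decidable.Core using (dec⇒maybe; recompute)
open import Relation.Unary using (Pred; _∈_; _⊆_; Satisfiable)
open import Defs

-- The inequality is quantified over all `v` and `ε` because the choice `v = F (γ c)` then gives
-- back the derivative at `c`: continuity of `F` makes `ε` small near `c`. The set `K` may be
-- neither convex nor connected, so `F` cannot be compared along straight segments in `K`. The
-- increment of `F` is therefore estimated along the curve itself, where the derivative of `F ∘ γ`
-- is `(DF)F ∘ γ`; this is the origin of the second norm in `G`. The mean value inequality, used
-- once on the whole interval, gives `t²` in place of `t² / 2`; halving plays the part of
-- integrating `s ↦ s M`. In the converse direction the exponent 2 is decisive: `2ⁿ` segments with
-- errors of order `4⁻ⁿ` have a total error of order `2⁻ⁿ`. On each of them `F` is evaluated at the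
-- starting vertex, a point of the limit curve, so the hypothesis on `F ∘ γ` applies there directly.
-- An end of an interval that is not dyadic costs a rough estimate on a single segment of level `n`,
-- which also vanishes in the limit.

module _ (em : ExcludedMiddle 0ℓ) (𝓕 : CompleteOrderedField) where

  open Analysis em 𝓕

  -- A ring solver over the reals with integer coefficients

  ℝ-ring : CommutativeRing 0ℓ 0ℓ
  ℝ-ring = record { isCommutativeRing = isCommutativeRing }

  module R = CommutativeRing ℝ-ring
  module RP = RingProperties R.ring
  open SemiringMult R.semiring using (1+×; ×-homo-+; ×1-homo-*) renaming (_×_ to _·_)

  -- The solver must compare coefficients by computation, which real numbers do not allow. Hence its
  -- coefficients are integers, interpreted in `ℝ` by this homomorphism.
  fromℤ : ℤ → ℝ
  fromℤ (ℤ.+ n)    = n · 1#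
  fromℤ (-[1+ n ]) = - (suc n · 1#)

  open ≡-Reasoning

  -‿+-distrib : ∀ x y → - (x + y) ≡ - x + - y
  -‿+-distrib x y = sym (RP.-‿+-comm x y)

  -0≡0 : - 0# ≡ 0#
  -0≡0 = RP.-0#≈0#

  fromℤ-⊖ : ∀ m n → fromℤ (m ℤ.⊖ n) ≡ m · 1# - n · 1#
  fromℤ-⊖ m zero = sym (trans (cong (m · 1# +_) -0≡0) (R.+-identityʳ _))
  fromℤ-⊖ zero (suc n) = sym (R.+-identityˡ _)
  fromℤ-⊖ (suc m) (suc n) = begin
    fromℤ (suc m ℤ.⊖ suc n)                 ≡⟨ cong fromℤ (ℤ.[1+m]⊖[1+n]≡m⊖n m n) ⟩
    fromℤ (m ℤ.⊖ n)                         ≡⟨ fromℤ-⊖ m n ⟩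
    a - b                                   ≡⟨ cong (_- b) (R.+-identityʳ a) ⟨
    (a + 0#) - b                            ≡⟨ cong (λ z → (a + z) - b) (R.-‿inverseʳ 1#) ⟨
    (a + (1# - 1#)) - b                     ≡⟨ cong (_- b) (R.+-assoc a 1# _) ⟨
    ((a + 1#) - 1#) - b                     ≡⟨ R.+-assoc (a + 1#) _ _ ⟩
    (a + 1#) + (- 1# + - b)                 ≡⟨ cong₂ _+_ (R.+-comm a 1#) (sym (-‿+-distrib 1# b)) ⟩
    (1# + a) - (1# + b)                     ≡⟨ cong₂ _-_ (1+× m 1#) (1+× n 1#) ⟨
    suc m · 1# - suc n · 1#                 ∎
    where
    a = m · 1#
    b = n · 1#

  fromℤ-neg : ∀ i → fromℤ (ℤ.- i) ≡ - fromℤ i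
  fromℤ-neg (ℤ.+ zero) = sym -0≡0
  fromℤ-neg +[1+ n ]   = refl
  fromℤ-neg -[1+ n ]   = sym (RP.-‿involutive _)

  fromℤ-+ : ∀ i j → fromℤ (i ℤ.+ j) ≡ fromℤ i + fromℤ j
  fromℤ-+ (ℤ.+ m)    (ℤ.+ n)    = ×-homo-+ 1# m n
  fromℤ-+ (ℤ.+ m)    (-[1+ n ]) = fromℤ-⊖ m (suc n)
  fromℤ-+ (-[1+ m ]) (ℤ.+ n)    = trans (fromℤ-⊖ n (suc m)) (R.+-comm _ _)
  fromℤ-+ (-[1+ m ]) (-[1+ n ]) = trans
    (cong (λ k → - (k · 1#)) (cong suc (sym (ℕ.+-suc m n))))
    (trans (cong -_ (×-homo-+ 1# (suc m) (suc n))) (-‿+-distrib _ _))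

  fromℤ-* : ∀ i j → fromℤ (i ℤ.* j) ≡ fromℤ i * fromℤ j
  fromℤ-* (ℤ.+ m) (ℤ.+ n) = trans (cong fromℤ (ℤ.+◃n≡+n (m ℕ.* n))) (×1-homo-* m n)
  fromℤ-* (ℤ.+ m) (-[1+ n ]) = begin
    fromℤ (ℤ.+ m ℤ.* -[1+ n ])              ≡⟨ cong fromℤ (ℤ.-◃n≡-n (m ℕ.* suc n)) ⟩
    fromℤ (ℤ.- (ℤ.+ (m ℕ.* suc n)))         ≡⟨ fromℤ-neg (ℤ.+ (m ℕ.* suc n)) ⟩
    - ((m ℕ.* suc n) · 1#)                ≡⟨ cong -_ (×1-homo-* m (suc n)) ⟩
    - (m · 1# * (suc n · 1#))             ≡⟨ RP.-‿distribʳ-* _ _ ⟩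
    m · 1# * - (suc n · 1#)               ∎
  fromℤ-* (-[1+ m ]) (ℤ.+ n) = begin
    fromℤ (-[1+ m ] ℤ.* ℤ.+ n)              ≡⟨ cong fromℤ (ℤ.-◃n≡-n (suc m ℕ.* n)) ⟩
    fromℤ (ℤ.- (ℤ.+ (suc m ℕ.* n)))         ≡⟨ fromℤ-neg (ℤ.+ (suc m ℕ.* n)) ⟩
    - ((suc m ℕ.* n) · 1#)                ≡⟨ cong -_ (×1-homo-* (suc m) n) ⟩
    - (suc m · 1# * (n · 1#))             ≡⟨ RP.-‿distribˡ-* _ _ ⟩
    - (suc m · 1#) * (n · 1#)             ∎
  fromℤ-* (-[1+ m ]) (-[1+ n ]) = begin
    (suc m ℕ.* suc n) · 1#                ≡⟨ ×1-homo-* (suc m) (suc n) ⟩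
    a * b                                 ≡⟨ RP.-‿involutive _ ⟨
    - - (a * b)                           ≡⟨ cong -_ (RP.-‿distribˡ-* a b) ⟩
    - (- a * b)                           ≡⟨ RP.-‿distribʳ-* (- a) b ⟩
    - a * - b                             ∎
    where
    a = suc m · 1#
    b = suc n · 1#

  ℤ-rawRing : RawRing 0ℓ 0ℓ
  ℤ-rawRing = CommutativeRing.rawRing ℤ.+-*-commutativeRing

  fromℤ-homomorphism : ℤ-rawRing -Raw-AlmostCommutative⟶ fromCommutativeRing ℝ-ring
  fromℤ-homomorphism = record
    { ⟦_⟧    = fromℤ
    ; +-homo = fromℤ-+
    ; *-homo = fromℤ-*
    ; -‿homo = fromℤ-neg
    ; 0-homo = refl
    ; 1-homo = refl
    }

  fromℤ-≟ : ∀ i j → Maybe (fromℤ i ≡ fromℤ j)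
  fromℤ-≟ i j = Maybe.map (cong fromℤ) (dec⇒maybe (i ℤ.≟ j))

  open RingSolver ℤ-rawRing (fromCommutativeRing ℝ-ring) fromℤ-homomorphism fromℤ-≟
    using (Polynomial; solve; con; _:=_; _:+_; _:*_; _:-_; :-_)

  :0 :1 :2 : ∀ {n} → Polynomial n
  :0 = con (ℤ.+ 0)
  :1 = con (ℤ.+ 1)
  :2 = con (ℤ.+ 2)

  -- Ordered field arithmetic

  open IsTotalOrder isTotalOrder
    using () renaming (refl to ≤-refl; trans to ≤-trans; antisym to ≤-antisym; total to ≤-total;
        reflexive to ≤-reflexive)

  gap : ∀ {x y} → x ≤ y → 0# ≤ y - x
  gap {x} {y} x≤y = subst (_≤ y - x) (R.-‿inverseʳ x) (+-monoˡ-≤ (- x) x≤y)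

  -- Inequalities are proved by writing the difference as a sum of products of
  -- nonnegative terms (built with gap, _⊞_ and _⊠_), an identity left to the ring solver.
  certify : ∀ {a b d} → 0# ≤ d → b ≡ a + d → a ≤ b
  certify {a} {b} {d} 0≤d b≡a+d = subst₂ _≤_ (R.+-identityˡ a) (trans (R.+-comm d a) (sym b≡a+d))
      (+-monoˡ-≤ a 0≤d)

  infixl 6 _⊞_
  infixl 7 _⊠_

  _⊞_ : ∀ {x y} → 0# ≤ x → 0# ≤ y → 0# ≤ x + y
  p ⊞ q = ≤-trans p (certify q refl)

  _⊠_ : ∀ {x y} → 0# ≤ x → 0# ≤ y → 0# ≤ x * y
  _⊠_ = *-nonneg

  <⇒≱ : ∀ {x y} → x < y → ¬ y ≤ x
  <⇒≱ (x≤y , x≢y) y≤x = x≢y (≤-antisym x≤y y≤x)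

  ≰⇒> : ∀ {x y} → ¬ x ≤ y → y < x
  ≰⇒> {x} {y} x≰y with ≤-total x y
  ... | inj₁ x≤y = ⊥-elim (x≰y x≤y)
  ... | inj₂ y≤x = y≤x , λ { refl → x≰y y≤x }

  ≮⇒≥ : ∀ {x y} → ¬ y < x → x ≤ y
  ≮⇒≥ {x} {y} y≮x with em {x ≤ y}
  ... | yes x≤y = x≤y
  ... | no x≰y  = ⊥-elim (y≮x (≰⇒> x≰y))

  <⇒≤ : ∀ {x y} → x < y → x ≤ y
  <⇒≤ = proj₁

  <-≤-trans : ∀ {x y z} → x < y → y ≤ z → x < z
  <-≤-trans (x≤y , x≢y) y≤z = ≤-trans x≤y y≤z , λ { refl → x≢y (≤-antisym x≤y y≤z) }

  ≤-<-trans : ∀ {x y z} → x ≤ y → y < z → x < z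
  ≤-<-trans x≤y (y≤z , y≢z) = ≤-trans x≤y y≤z , λ { refl → y≢z (≤-antisym y≤z x≤y) }

  gap< : ∀ {x y} → x < y → 0# < y - x
  gap< {x} {y} (x≤y , x≢y) = gap x≤y , λ 0≡ → x≢y (begin
    x             ≡⟨ R.+-identityˡ x ⟨
    0# + x        ≡⟨ cong (_+ x) 0≡ ⟩
    (y - x) + x   ≡⟨ solve 2 (λ x y → (y :- x) :+ x := y) refl x y ⟩
    y             ∎)

  certify< : ∀ {a b d} → 0# < d → b ≡ a + d → a < b
  certify< {a} {b} {d} (0≤d , 0≢d) b≡a+d = certify 0≤d b≡a+d , λ a≡b → 0≢d (begin
    0#            ≡⟨ R.-‿inverseʳ a ⟨
    a - a         ≡⟨ cong (_- a) (trans a≡b b≡a+d) ⟩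
    (a + d) - a   ≡⟨ solve 2 (λ a d → (a :+ d) :- a := d) refl a d ⟩
    d             ∎)

  0<+ : ∀ {x y} → 0# < x → 0# ≤ y → 0# < x + y
  0<+ p q = <-≤-trans p (certify q refl)

  *-zero-divisor : ∀ {x y} → x ≢ 0# → x * y ≡ 0# → y ≡ 0#
  *-zero-divisor {x} {y} x≢0 xy≡0 = begin
    y              ≡⟨ R.*-identityˡ y ⟨
    1# * y         ≡⟨ cong (_* y) xz≡1 ⟨
    x * z * y      ≡⟨ solve 3 (λ x y z → x :* z :* y := z :* (x :* y)) refl x y z ⟩
    z * (x * y)    ≡⟨ cong (z *_) xy≡0 ⟩
    z * 0#         ≡⟨ R.zeroʳ z ⟩
    0#             ∎
    where
    z = proj₁ (inverse x x≢0)
    xz≡1 = proj₂ (inverse x x≢0)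

  0<* : ∀ {x y} → 0# < x → 0# < y → 0# < x * y
  0<* (0≤x , 0≢x) (0≤y , 0≢y) =
    0≤x ⊠ 0≤y , λ 0≡xy → 0≢y (sym (*-zero-divisor (λ x≡0 → 0≢x (sym x≡0)) (sym 0≡xy)))

  +-mono-≤ : ∀ {x y u v} → x ≤ y → u ≤ v → x + u ≤ y + v
  +-mono-≤ p q = certify (gap p ⊞ gap q)
    (solve 4 (λ x y u v → y :+ v := x :+ u :+ ((y :- x) :+ (v :- u))) refl _ _ _ _)

  *-monoˡ-≤ : ∀ {c x y} → 0# ≤ c → x ≤ y → c * x ≤ c * y
  *-monoˡ-≤ p q = certify (p ⊠ gap q)
    (solve 3 (λ c x y → c :* y := c :* x :+ c :* (y :- x)) refl _ _ _)

  *-monoʳ-≤ : ∀ {c x y} → 0# ≤ c → x ≤ y → x * c ≤ y * c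
  *-monoʳ-≤ p q = certify (p ⊠ gap q)
    (solve 3 (λ c x y → y :* c := x :* c :+ c :* (y :- x)) refl _ _ _)

  x*x≥0 : ∀ x → 0# ≤ x * x
  x*x≥0 x with ≤-total 0# x
  ... | inj₁ 0≤x = 0≤x ⊠ 0≤x
  ... | inj₂ x≤0 = subst (0# ≤_) (solve 1 (λ x → (:0 :- x) :* (:0 :- x) := x :* x) refl x)
      (gap x≤0 ⊠ gap x≤0)

  -- If `y < x`, then `x² - y² = (x - y) (x + y)` is positive. Absolute values, roots and norms are
  -- known through their squares and are compared by this.
  sq-cancel-≤ : ∀ {x y} → 0# ≤ y → x * x ≤ y * y → x ≤ y
  sq-cancel-≤ {x} {y} 0≤y x²≤y² = ≮⇒≥ λ y<x → (<⇒≱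
    (certify< (0<* (gap< y<x) (0<+ (≤-<-trans 0≤y y<x) 0≤y))
      (solve 2 (λ x y → x :* x := y :* y :+ (x :- y) :* (x :+ y)) refl x y))
    x²≤y²)

  sq-injective : ∀ {x y} → 0# ≤ x → 0# ≤ y → x * x ≡ y * y → x ≡ y
  sq-injective 0≤x 0≤y eq =
    ≤-antisym (sq-cancel-≤ 0≤y (≤-reflexive eq)) (sq-cancel-≤ 0≤x (≤-reflexive (sym eq)))

  0<1 : 0# < 1#
  0<1 = 0≤1 , 0≢1

  ½+½ : ½ + ½ ≡ 1#
  ½+½ = trans (solve 1 (λ h → h :+ h := :2 :* h) refl ½) (proj₂ (inverse 2# 2≢0))

  ½x+½x : ∀ x → ½ * x + ½ * x ≡ x
  ½x+½x x = trans (sym (R.distribʳ x ½ ½)) (trans (cong (_* x) ½+½) (R.*-identityˡ x))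

  0<½ : 0# < ½
  0<½ = 0≤½ , λ 0≡½ → 0≢1 (trans (sym (R.+-identityˡ 0#)) (trans (cong₂ _+_ 0≡½ 0≡½) ½+½))

  0<½* : ∀ {x} → 0# < x → 0# < ½ * x
  0<½* = 0<* 0<½

  ½*< : ∀ {x} → 0# < x → ½ * x < x
  ½*< {x} 0<x = certify< (0<½* 0<x) (sym (½x+½x x))

  ½*≤ : ∀ {x} → 0# ≤ x → ½ * x ≤ x
  ½*≤ {x} 0≤x = certify (0≤½ ⊠ 0≤x) (sym (½x+½x x))

  -- For identities that the ring solver can only prove modulo l ≡ r.
  ≡-via : ∀ {a b l r} → l ≡ r → a + r ≡ b + l → a ≡ b
  ≡-via {a} {b} {l} refl eq = RP.+-cancelʳ l a b eq

  reciprocal : ∀ {x} → 0# < x → ∃ λ y → 0# < y × x * y ≡ 1#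
  reciprocal {x} (0≤x , 0≢x) = y , ≰⇒> (λ y≤0 → <⇒≱ 0<1 (certify (0≤x ⊠ gap y≤0)
    (≡-via xy≡1 (solve 2 (λ x y → :0 :+ :1 := :1 :+ x :* (:0 :- y) :+ x :* y) refl x y)))) , xy≡1
    where
    y = proj₁ (inverse x (λ x≡0 → 0≢x (sym x≡0)))
    xy≡1 = proj₂ (inverse x (λ x≡0 → 0≢x (sym x≡0)))

  smaller : ∀ {a b} → 0# < a → 0# < b → ∃ λ m → 0# < m × m ≤ a × m ≤ b
  smaller {a} {b} 0<a 0<b with ≤-total a b
  ... | inj₁ a≤b = a , 0<a , ≤-refl , a≤b
  ... | inj₂ b≤a = b , 0<b , b≤a , ≤-refl

  -- The witness is `ε / (1 + c)`; the summand 1 admits `c = 0` without a case distinction.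
  scaled-below : ∀ {ε c} → 0# < ε → 0# ≤ c → ∃ λ δ → 0# < δ × δ * c ≤ ε
  scaled-below {ε} {c} 0<ε 0≤c with reciprocal (0<+ 0<1 0≤c)
  ... | r , 0<r , [1+c]r≡1 = ε * r , 0<* 0<ε 0<r , certify (<⇒≤ (0<* 0<ε 0<r))
    (≡-via (cong (ε *_) (sym [1+c]r≡1))
      (solve 3 (λ ε r c → ε :+ ε :* ((:1 :+ c) :* r) :=
          ε :* r :* c :+ ε :* r :+ ε :* :1) refl ε r c))

  ≤-limit : ∀ {a b c} → 0# ≤ c → (∀ ε → 0# < ε → a ≤ b + ε * c) → a ≤ b
  ≤-limit {a} {b} {c} 0≤c a≤b+εc = ≮⇒≥ λ b<a →
    let ε , 0<ε , εc≤ = scaled-below (0<½* (gap< b<a)) 0≤c in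
    (<⇒≱ (0<½* (gap< b<a))
      (certify (gap (a≤b+εc ε 0<ε) ⊞ gap εc≤)
        (≡-via (sym (½x+½x (a - b))) (solve 4 (λ a b e h →
          :0 :+ (h :+ h) := h :+ (b :+ e :- a :+ (h :- e)) :+ (a :- b)) refl a b (ε * c)
              (½ * (a - b))))))

  ≤½* : ∀ {x y} → x + x ≤ y → x ≤ ½ * y
  ≤½* {x} {y} p = certify (0≤½ ⊠ gap p)
    (≡-via (½x+½x x) (solve 3 (λ h x y → h :* y :+ x :=
        x :+ h :* (y :- (x :+ x)) :+ (h :* x :+ h :* x)) refl ½ x y))

  ≤½*⁻¹ : ∀ {x y} → x ≤ ½ * y → x + x ≤ y
  ≤½*⁻¹ {x} {y} p = subst (x + x ≤_) (½x+½x y) (+-mono-≤ p p)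

  -- hal n t = t / 2ⁿ
  hal : ℕ → ℝ → ℝ
  hal zero    t = t
  hal (suc n) t = hal n (½ * t)

  hal-* : ∀ n c t → hal n (c * t) ≡ c * hal n t
  hal-* zero    c t = refl
  hal-* (suc n) c t = trans (cong (hal n)
      (solve 3 (λ h c t → h :* (c :* t) := c :* (h :* t)) refl ½ c t)) (hal-* n c (½ * t))

  hal-nonneg : ∀ n {t} → 0# ≤ t → 0# ≤ hal n t
  hal-nonneg zero    p = p
  hal-nonneg (suc n) p = hal-nonneg n (0≤½ ⊠ p)

  -- The Archimedean property, from completeness: the numbers below every `e / 2ⁿ` are closed under
  -- doubling, so their supremum `s` satisfies `s ≤ s / 2`, that is, `s ≤ 0`.
  hal-archimedean : ∀ {d e} → (∀ n → d ≤ hal n e) → d ≤ 0#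
  hal-archimedean {d} {e} d≤ = ≤-trans (ub d d≤) (half-nonpos (lub (½ * s) λ x x∈S →
    ≤½* (subst (_≤ s) (solve 1 (λ x → :2 :* x := x :+ x) refl x) (ub (2# * x) (doubled x x∈S)))))
    where
    S : Pred ℝ 0ℓ
    S x = ∀ n → x ≤ hal n e

    s = proj₁ (complete S (d , d≤) (e , λ x x∈S → x∈S 0))
    ub = proj₁ (proj₂ (complete S (d , d≤) (e , λ x x∈S → x∈S 0)))
    lub = proj₂ (proj₂ (complete S (d , d≤) (e , λ x x∈S → x∈S 0)))

    doubled : ∀ x → x ∈ S → (2# * x) ∈ S
    doubled x x∈S n = certify (gap (x≤½ n) ⊞ gap (x≤½ n))
      (≡-via (sym (½x+½x (hal n e)))
          (solve 3 (λ h y x → y :+ (h :+ h) := :2 :* x :+ (h :- x :+ (h :- x)) :+ y) refl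
          (½ * hal n e) (hal n e) x))
      where
      x≤½ : ∀ n → x ≤ ½ * hal n e
      x≤½ n = subst (x ≤_) (hal-* n ½ e) (x∈S (suc n))

    half-nonpos : s ≤ ½ * s → s ≤ 0#
    half-nonpos s≤½s = certify (gap s≤½s ⊞ gap s≤½s)
      (≡-via (sym (½x+½x s)) (solve 2 (λ s h → :0 :+ (h :+ h) :=
          s :+ (h :- s :+ (h :- s)) :+ s) refl s (½ * s)))

  ≤-hal-limit : ∀ {a b} c t → (∀ n → a ≤ b + c * hal n t) → a ≤ b
  ≤-hal-limit {a} {b} c t a≤ = certify
      (gap (hal-archimedean {a - b} λ n → subst (a - b ≤_) (sym (hal-* n c t))
      (certify (gap (a≤ n)) (solve 3 (λ a b h → h := a :- b :+ (b :+ h :- a)) refl a b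
          (c * hal n t)))))
    (solve 2 (λ a b → b := a :+ (:0 :- (a :- b))) refl a b)

  hal-small : ∀ C t {ε} → 0# < ε → ∃ λ n → C * hal n t ≤ ε
  hal-small C t {ε} 0<ε with em {∃ λ n → C * hal n t ≤ ε}
  ... | yes found = found
  ... | no none   = ⊥-elim (<⇒≱ 0<ε
      (hal-archimedean λ n → subst (ε ≤_) (sym (hal-* n C t)) (<⇒≤ (≰⇒> λ small →
      none (n , small)))))

  -- Absolute values and square roots

  abs-nonneg : ∀ x → 0# ≤ abs x
  abs-nonneg x with ≤-total 0# x
  ... | inj₁ 0≤x = 0≤x
  ... | inj₂ x≤0 = subst (0# ≤_) (R.+-identityˡ (- x)) (gap x≤0)

  abs-sq : ∀ x → abs x * abs x ≡ x * x
  abs-sq x with ≤-total 0# x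
  ... | inj₁ _ = refl
  ... | inj₂ _ = solve 1 (λ x → (:- x) :* (:- x) := x :* x) refl x

  nonneg⇒abs : ∀ {x} → 0# ≤ x → abs x ≡ x
  nonneg⇒abs {x} 0≤x = sq-injective (abs-nonneg x) 0≤x (abs-sq x)

  ≤-total-strict : ∀ x y → x ≤ y ⊎ y < x
  ≤-total-strict x y with em {x ≤ y}
  ... | yes x≤y = inj₁ x≤y
  ... | no x≰y  = inj₂ (≰⇒> x≰y)

  abs-neg : ∀ x → abs (- x) ≡ abs x
  abs-neg x = sq-injective (abs-nonneg _) (abs-nonneg x)
    (trans (abs-sq (- x)) (trans (solve 1 (λ x → (:- x) :* (:- x) := x :* x) refl x)
        (sym (abs-sq x))))

  nonpos⇒abs : ∀ {x} → x ≤ 0# → abs x ≡ - x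
  nonpos⇒abs {x} x≤0 = trans (sym (abs-neg x))
      (nonneg⇒abs (subst (0# ≤_) (R.+-identityˡ (- x)) (gap x≤0)))

  x≤abs : ∀ x → x ≤ abs x
  x≤abs x = sq-cancel-≤ (abs-nonneg x) (≤-reflexive (sym (abs-sq x)))

  abs-≤ : ∀ {x c} → x ≤ c → - x ≤ c → abs x ≤ c
  abs-≤ {x} x≤c -x≤c with ≤-total 0# x
  ... | inj₁ _ = x≤c
  ... | inj₂ _ = -x≤c

  IsSqrt : ℝ → ℝ → Set
  IsSqrt a r = 0# ≤ r × r * r ≡ a

  sup-isSupremum : ∀ {S} → Satisfiable S → Satisfiable (UpperBound S) → IsSupremum S (sup S)
  sup-isSupremum {S} ne bd with em {Satisfiable S × Satisfiable (UpperBound S)}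
  ... | yes (ne′ , bd′) = proj₂ (complete S ne′ bd′)
  ... | no ¬p           = ⊥-elim (¬p (ne , bd))

  √-isSqrt : ∀ {a} → 0# ≤ a → IsSqrt a (√ a)
  √-isSqrt {a} 0≤a = 0≤s , ≤-antisym (≮⇒≥ too-big) (≮⇒≥ too-small)
    where
    S : Pred ℝ 0ℓ
    S r = r * r ≤ a

    0∈S : 0# ∈ S
    0∈S = subst (_≤ a) (sym (R.zeroʳ 0#)) 0≤a

    bound : (1# + a) ∈ UpperBound S
    bound r r²≤a = sq-cancel-≤ (0≤1 ⊞ 0≤a) (certify (gap r²≤a ⊞ 0≤1 ⊞ 0≤a ⊞ x*x≥0 a)
      (solve 2 (λ a r → (:1 :+ a) :* (:1 :+ a) :=
          r :* r :+ (a :- r :* r :+ :1 :+ a :+ a :* a)) refl a r))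

    s = √ a
    isSup = sup-isSupremum {S} (0# , 0∈S) (1# + a , bound)

    0≤s : 0# ≤ s
    0≤s = proj₁ isSup 0# 0∈S

    -- If s² > a then the Newton step (s + a / s) / 2 is a smaller upper bound.
    too-big : ¬ a < s * s
    too-big a<s² = <⇒≱ a<s² (certify (gap s≤a/s ⊠ 0≤s)
        (≡-via (sym (cong (a *_) sy≡1))
            (solve 3 (λ a s y → a :+ a :* (s :* y) :=
            s :* s :+ (a :* y :- s) :* s :+ a :* :1) refl a s y)))
      where
      0<s : 0# < s
      0<s = 0≤s , λ 0≡s → <⇒≱ a<s² (subst (λ z → z * z ≤ a) 0≡s 0∈S)

      y = proj₁ (reciprocal 0<s)
      0<y = proj₁ (proj₂ (reciprocal 0<s))
      sy≡1 = proj₂ (proj₂ (reciprocal 0<s))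

      s+s≤ : s + s ≤ s + a * y
      s+s≤ = ≤½*⁻¹ (proj₂ isSup _ λ r r²≤a → ≤½* (sq-cancel-≤ (0≤s ⊞ (0≤a ⊠ <⇒≤ 0<y))
        (certify ((0≤1 ⊞ 0≤1) ⊠ (0≤1 ⊞ 0≤1) ⊠ gap r²≤a ⊞ x*x≥0 (s - a * y))
          (≡-via (cong (2# * 2# * a *_) sy≡1) (solve 4 (λ a r s y →
            (s :+ a :* y) :* (s :+ a :* y) :+ :2 :* :2 :* a :* :1 :=
            (r :+ r) :* (r :+ r) :+
                (:2 :* :2 :* (a :- r :* r) :+ (s :- a :* y) :* (s :- a :* y)) :+ :2 :* :2 :* a :*
                (s :* y))
            refl a r s y)))))

      s≤a/s : s ≤ a * y
      s≤a/s = certify (gap s+s≤) (solve 2 (λ s z → z := s :+ (s :+ z :- (s :+ s))) refl s (a * y))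

    too-small : ¬ s * s < a
    -- For `δ ≤ 1`, `(s + δ)²` is at most `s² + δ (2 s + 1)`; a `δ` with `δ (2 s + 1) ≤ a - s²`
    -- keeps `s + δ` in `S`, above its supremum.
    too-small s²<a =
      let δ₀ , 0<δ₀ , δ₀c≤e = scaled-below (gap< s²<a) (0≤s ⊞ 0≤s ⊞ 0≤1)
          δ , 0<δ , δ≤δ₀ , δ≤1 = smaller 0<δ₀ 0<1
      in <⇒≱ (certify< {s} {s + δ} 0<δ refl) (proj₁ isSup (s + δ)
        (certify (gap δ₀c≤e ⊞ gap δ≤δ₀ ⊠ (0≤s ⊞ 0≤s ⊞ 0≤1) ⊞ <⇒≤ 0<δ ⊠ gap δ≤1)
          (solve 4 (λ a s δ ε → a := (s :+ δ) :* (s :+ δ) :+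
              (a :- s :* s :- ε :* (s :+ s :+ :1) :+ (ε :- δ) :* (s :+ s :+ :1) :+ δ :* (:1 :- δ)))
            refl a s δ δ₀)))

  -- The Euclidean norm

  ∙-self-nonneg : ∀ {N} (x : ℝ^ N) → 0# ≤ x ∙ x
  ∙-self-nonneg []      = ≤-refl
  ∙-self-nonneg (x ∷ xs) = x*x≥0 x ⊞ ∙-self-nonneg xs

  norm-nonneg : ∀ {N} (x : ℝ^ N) → 0# ≤ ∣ x ∣
  norm-nonneg x = proj₁ (√-isSqrt (∙-self-nonneg x))

  norm-sq : ∀ {N} (x : ℝ^ N) → ∣ x ∣ * ∣ x ∣ ≡ x ∙ x
  norm-sq x = proj₂ (√-isSqrt (∙-self-nonneg x))

  norm-≤ : ∀ {N} (x : ℝ^ N) {c} → 0# ≤ c → x ∙ x ≤ c * c → ∣ x ∣ ≤ c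
  norm-≤ x 0≤c p = sq-cancel-≤ 0≤c (subst (_≤ _) (sym (norm-sq x)) p)

  -- Induction on the dimension. With `p = ∣ xs ∣` and `q = ∣ ys ∣` the step is the planar
  -- inequality for `(x , p)` and `(y , q)`, read off Lagrange's identity `(x² + p²) (y² + q²) = (x
  -- y + p q)² + (x q - p y)²`.
  cauchy-schwarz : ∀ {N} (x y : ℝ^ N) → x ∙ y ≤ ∣ x ∣ * ∣ y ∣
  cauchy-schwarz []       []       = norm-nonneg [] ⊠ norm-nonneg []
  cauchy-schwarz (x ∷ xs) (y ∷ ys) = ≤-trans
    (+-mono-≤ {x * y} ≤-refl (cauchy-schwarz xs ys))
    (sq-cancel-≤ (norm-nonneg (x ∷ xs) ⊠ norm-nonneg (y ∷ ys))
      (certify (x*x≥0 (x * ∣ ys ∣ - ∣ xs ∣ * y)) (begin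
        (A * B) * (A * B)                        ≡⟨ solve 2
            (λ A B → (A :* B) :* (A :* B) := (A :* A) :* (B :* B)) refl A B ⟩
        (A * A) * (B * B)                        ≡⟨ cong₂ _*_ (norm-sq (x ∷ xs))
            (norm-sq (y ∷ ys)) ⟩
        (x * x + xs ∙ xs) * (y * y + ys ∙ ys)    ≡⟨ cong₂ (λ u v → (x * x + u) * (y * y + v))
            (norm-sq xs) (norm-sq ys) ⟨
        (x * x + p * p) * (y * y + q * q)        ≡⟨ solve 4
            (λ x y p q → (x :* x :+ p :* p) :* (y :* y :+ q :* q) := (x :* y :+ p :* q) :*
            (x :* y :+ p :* q) :+ (x :* q :- p :* y) :* (x :* q :- p :* y)) refl x y p q ⟩
        (x * y + p * q) * (x * y + p * q) + (x * q - p * y) * (x * q - p * y) ∎)))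
    where
    A = ∣ x ∷ xs ∣
    B = ∣ y ∷ ys ∣
    p = ∣ xs ∣
    q = ∣ ys ∣

  ∙-⊕-expand : ∀ {N} (x y : ℝ^ N) → (x ⊕ y) ∙ (x ⊕ y) ≡ x ∙ x + 2# * (x ∙ y) + y ∙ y
  ∙-⊕-expand []       []       = solve 0 (:0 := :0 :+ :2 :* :0 :+ :0) refl
  ∙-⊕-expand (x ∷ xs) (y ∷ ys) = trans (cong ((x + y) * (x + y) +_) (∙-⊕-expand xs ys))
    (solve 5 (λ x y a b c → (x :+ y) :* (x :+ y) :+ (a :+ :2 :* b :+ c) := (x :* x :+ a) :+ :2 :*
        (x :* y :+ b) :+ (y :* y :+ c)) refl x y (xs ∙ xs) (xs ∙ ys) (ys ∙ ys))

  triangle : ∀ {N} (x y : ℝ^ N) → ∣ x ⊕ y ∣ ≤ ∣ x ∣ + ∣ y ∣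
  triangle x y = norm-≤ (x ⊕ y) (norm-nonneg x ⊞ norm-nonneg y)
    (certify ((0≤1 ⊞ 0≤1) ⊠ gap (cauchy-schwarz x y)) (begin
      (A + B) * (A + B)                     ≡⟨ solve 2 (λ A B → (A :+ B) :* (A :+ B) :=
          A :* A :+ :2 :* (A :* B) :+ B :* B) refl A B ⟩
      A * A + 2# * (A * B) + B * B          ≡⟨ cong₂ (λ u v → u + 2# * (A * B) + v) (norm-sq x)
          (norm-sq y) ⟩
      x ∙ x + 2# * (A * B) + y ∙ y          ≡⟨ solve 4
          (λ a b c d → a :+ :2 :* b :+ c := (a :+ :2 :* d :+ c) :+ :2 :* (b :- d)) refl (x ∙ x)
          (A * B) (y ∙ y) (x ∙ y) ⟩
      (x ∙ x + 2# * (x ∙ y) + y ∙ y) + 2# * (A * B - x ∙ y) ≡⟨ cong (_+ 2# * (A * B - x ∙ y))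
          (∙-⊕-expand x y) ⟨
      (x ⊕ y) ∙ (x ⊕ y) + 2# * (A * B - x ∙ y) ∎))
    where
    A = ∣ x ∣
    B = ∣ y ∣

  ∙-⊙ˡ : ∀ {N} c (x y : ℝ^ N) → (c ⊙ x) ∙ y ≡ c * (x ∙ y)
  ∙-⊙ˡ c []       []       = sym (R.zeroʳ c)
  ∙-⊙ˡ c (x ∷ xs) (y ∷ ys) = trans (cong (c * x * y +_) (∙-⊙ˡ c xs ys))
    (solve 4 (λ c x y s → c :* x :* y :+ c :* s := c :* (x :* y :+ s)) refl c x y (xs ∙ ys))

  ∙-comm : ∀ {N} (x y : ℝ^ N) → x ∙ y ≡ y ∙ x
  ∙-comm []       []       = refl
  ∙-comm (x ∷ xs) (y ∷ ys) = cong₂ _+_ (R.*-comm x y) (∙-comm xs ys)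

  norm-⊙ : ∀ {N} c (x : ℝ^ N) → ∣ c ⊙ x ∣ ≡ abs c * ∣ x ∣
  norm-⊙ c x = sq-injective (norm-nonneg (c ⊙ x)) (abs-nonneg c ⊠ norm-nonneg x) (begin
    ∣ c ⊙ x ∣ * ∣ c ⊙ x ∣       ≡⟨ norm-sq (c ⊙ x) ⟩
    (c ⊙ x) ∙ (c ⊙ x)           ≡⟨ ∙-⊙ˡ c x (c ⊙ x) ⟩
    c * (x ∙ (c ⊙ x))           ≡⟨ cong (c *_) (trans (∙-comm x (c ⊙ x)) (∙-⊙ˡ c x x)) ⟩
    c * (c * (x ∙ x))           ≡⟨ R.*-assoc c c _ ⟨
    (c * c) * (x ∙ x)           ≡⟨ cong₂ _*_ (abs-sq c) (norm-sq x) ⟨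
    (abs c * abs c) * (∣ x ∣ * ∣ x ∣) ≡⟨ solve 2
        (λ a b → (a :* a) :* (b :* b) := (a :* b) :* (a :* b)) refl (abs c) ∣ x ∣ ⟩
    (abs c * ∣ x ∣) * (abs c * ∣ x ∣) ∎)

  norm-⊙-nonneg : ∀ {N c} → 0# ≤ c → (x : ℝ^ N) → ∣ c ⊙ x ∣ ≡ c * ∣ x ∣
  norm-⊙-nonneg {c = c} 0≤c x = trans (norm-⊙ c x) (cong (_* ∣ x ∣) (nonneg⇒abs 0≤c))

  norm-tail : ∀ {N} x (xs : ℝ^ N) → ∣ xs ∣ ≤ ∣ x ∷ xs ∣
  norm-tail x xs = norm-≤ xs (norm-nonneg (x ∷ xs)) (subst (xs ∙ xs ≤_) (sym (norm-sq (x ∷ xs)))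
    (certify (x*x≥0 x) (R.+-comm _ _)))

  abs-head : ∀ {N} x (xs : ℝ^ N) → abs x ≤ ∣ x ∷ xs ∣
  abs-head x xs = sq-cancel-≤ (norm-nonneg (x ∷ xs))
      (subst₂ _≤_ (sym (abs-sq x)) (sym (norm-sq (x ∷ xs)))
    (certify (∙-self-nonneg xs) refl))

  norm-∷ : ∀ {N} x (xs : ℝ^ N) → ∣ x ∷ xs ∣ ≤ abs x + ∣ xs ∣
  norm-∷ x xs = norm-≤ (x ∷ xs) (abs-nonneg x ⊞ norm-nonneg xs)
    (subst₂ (λ u v → u + v ≤ (abs x + ∣ xs ∣) * (abs x + ∣ xs ∣)) (abs-sq x) (norm-sq xs)
      (certify ((0≤1 ⊞ 0≤1) ⊠ (abs-nonneg x ⊠ norm-nonneg xs))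
        (solve 2 (λ a b → (a :+ b) :* (a :+ b) := a :* a :+ b :* b :+ :2 :* (a :* b)) refl
            (abs x) ∣ xs ∣)))

  ⊖-split : ∀ {N} (p q r : ℝ^ N) → p ⊖ r ≡ (p ⊖ q) ⊕ (q ⊖ r)
  ⊖-split []      []      []      = refl
  ⊖-split (p ∷ ps) (q ∷ qs) (r ∷ rs) = cong₂ _∷_
      (solve 3 (λ p q r → p :- r := (p :- q) :+ (q :- r)) refl p q r) (⊖-split ps qs rs)

  dist-triangle : ∀ {N} (p q r : ℝ^ N) → ∣ p ⊖ r ∣ ≤ ∣ p ⊖ q ∣ + ∣ q ⊖ r ∣
  dist-triangle p q r = subst (λ z → ∣ z ∣ ≤ ∣ p ⊖ q ∣ + ∣ q ⊖ r ∣) (sym (⊖-split p q r))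
      (triangle (p ⊖ q) (q ⊖ r))

  -1⊙-⊖ : ∀ {N} (p q : ℝ^ N) → q ⊖ p ≡ (- 1#) ⊙ (p ⊖ q)
  -1⊙-⊖ []       []       = refl
  -1⊙-⊖ (p ∷ ps) (q ∷ qs) = cong₂ _∷_ (solve 2 (λ p q → q :- p := (:- :1) :* (p :- q)) refl p q)
      (-1⊙-⊖ ps qs)

  norm-neg : ∀ {N} (x : ℝ^ N) → ∣ (- 1#) ⊙ x ∣ ≡ ∣ x ∣
  norm-neg x = trans (norm-⊙ (- 1#) x)
      (trans (cong (_* ∣ x ∣) (trans (abs-neg 1#) (nonneg⇒abs 0≤1))) (R.*-identityˡ _))

  dist-comm : ∀ {N} (p q : ℝ^ N) → ∣ q ⊖ p ∣ ≡ ∣ p ⊖ q ∣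
  dist-comm p q = trans (cong ∣_∣ (-1⊙-⊖ p q)) (norm-neg (p ⊖ q))

  x⊖x : ∀ {N} (x : ℝ^ N) → x ⊖ x ≡ 0# ⊙ x
  x⊖x []       = refl
  x⊖x (x ∷ xs) = cong₂ _∷_ (solve 1 (λ x → x :- x := :0 :* x) refl x) (x⊖x xs)

  dist-self : ∀ {N} (x : ℝ^ N) → ∣ x ⊖ x ∣ ≡ 0#
  dist-self x = trans (cong ∣_∣ (x⊖x x)) (trans (norm-⊙-nonneg ≤-refl x) (R.zeroˡ _))

  abs-≤0 : ∀ {x} → abs x ≤ 0# → x ≡ 0#
  abs-≤0 {x} p = ≤-antisym (≤-trans (x≤abs x) p)
      (certify (gap (≤-trans (subst (- x ≤_) (abs-neg x) (x≤abs (- x))) p))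
    (solve 1 (λ x → x := :0 :+ (:0 :- (:- x))) refl x))

  dist-≤0⇒≡ : ∀ {N} (p q : ℝ^ N) → ∣ p ⊖ q ∣ ≤ 0# → p ≡ q
  dist-≤0⇒≡ []       []       _ = refl
  dist-≤0⇒≡ (p ∷ ps) (q ∷ qs) d = cong₂ _∷_
    (≡-via (abs-≤0 (≤-trans (abs-head (p - q) (ps ⊖ qs)) d))
        (solve 2 (λ p q → p :+ :0 := q :+ (p :- q)) refl p q))
    (dist-≤0⇒≡ ps qs (≤-trans (norm-tail (p - q) (ps ⊖ qs)) d))

  𝟎 : ∀ {N} → ℝ^ N
  𝟎 {N} = replicate N 0#

  ⊖-𝟎 : ∀ {N} (x : ℝ^ N) → x ⊖ 𝟎 ≡ x
  ⊖-𝟎 []       = refl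
  ⊖-𝟎 (x ∷ xs) = cong₂ _∷_ (solve 1 (λ x → x :- :0 := x) refl x) (⊖-𝟎 xs)

  -- The deviation of q from p + a v.
  dev : ∀ {N} → ℝ^ N → ℝ^ N → ℝ → ℝ^ N → ℝ
  dev p q a v = ∣ q ⊖ p ⊖ a ⊙ v ∣

  dev-𝟎 : ∀ {N} (p q : ℝ^ N) a → dev p q a 𝟎 ≡ ∣ q ⊖ p ∣
  dev-𝟎 p q a = cong ∣_∣ (go p q)
    where
    go : ∀ {N} (p q : ℝ^ N) → q ⊖ p ⊖ a ⊙ 𝟎 ≡ q ⊖ p
    go []       []       = refl
    go (p ∷ ps) (q ∷ qs) = cong₂ _∷_ (solve 3 (λ p q a → q :- p :- a :* :0 := q :- p) refl p q a)
        (go ps qs)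

  dev-trans : ∀ {N} (p q r : ℝ^ N) a b v → dev p r (a + b) v ≤ dev p q a v + dev q r b v
  dev-trans p q r a b v = subst (λ z → ∣ z ∣ ≤ dev p q a v + dev q r b v) (sym (go p q r v))
      (triangle (q ⊖ p ⊖ a ⊙ v) (r ⊖ q ⊖ b ⊙ v))
    where
    go : ∀ {N} (p q r v : ℝ^ N) → r ⊖ p ⊖ (a + b) ⊙ v ≡ (q ⊖ p ⊖ a ⊙ v) ⊕ (r ⊖ q ⊖ b ⊙ v)
    go []       []       []       []       = refl
    go (p ∷ ps) (q ∷ qs) (r ∷ rs) (v ∷ vs) = cong₂ _∷_
      (solve 6 (λ p q r v a b → r :- p :- (a :+ b) :* v := (q :- p :- a :* v) :+
          (r :- q :- b :* v)) refl p q r v a b) (go ps qs rs vs)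

  dev-sym : ∀ {N} (p q : ℝ^ N) r s v → dev q p (s - r) v ≡ dev p q (r - s) v
  dev-sym p q r s v = trans (cong ∣_∣ (go p q v)) (norm-neg (q ⊖ p ⊖ (r - s) ⊙ v))
    where
    go : ∀ {N} (p q v : ℝ^ N) → p ⊖ q ⊖ (s - r) ⊙ v ≡ (- 1#) ⊙ (q ⊖ p ⊖ (r - s) ⊙ v)
    go []       []       []       = refl
    go (p ∷ ps) (q ∷ qs) (v ∷ vs) = cong₂ _∷_
      (solve 5 (λ p q v r s → p :- q :- (s :- r) :* v := (:- :1) :*
          (q :- p :- (r :- s) :* v)) refl p q v r s) (go ps qs vs)

  dev-change : ∀ {N} (p q : ℝ^ N) {a} → 0# ≤ a → ∀ v w → dev p q a v ≤ dev p q a w + a * ∣ w ⊖ v ∣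
  dev-change p q {a} 0≤a v w = subst₂ (λ z u → ∣ z ∣ ≤ dev p q a w + u) (sym (go p q v w))
      (norm-⊙-nonneg 0≤a (w ⊖ v)) (triangle (q ⊖ p ⊖ a ⊙ w) (a ⊙ (w ⊖ v)))
    where
    go : ∀ {N} (p q v w : ℝ^ N) → q ⊖ p ⊖ a ⊙ v ≡ (q ⊖ p ⊖ a ⊙ w) ⊕ a ⊙ (w ⊖ v)
    go []       []       []       []       = refl
    go (p ∷ ps) (q ∷ qs) (v ∷ vs) (w ∷ ws) = cong₂ _∷_
      (solve 5 (λ p q v w a → q :- p :- a :* v := (q :- p :- a :* w) :+ a :*
          (w :- v)) refl p q v w a) (go ps qs vs ws)

  dev-≤ : ∀ {N} (p q : ℝ^ N) {a} → 0# ≤ a → ∀ v → dev p q a v ≤ ∣ q ⊖ p ∣ + a * ∣ v ∣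
  dev-≤ p q {a} 0≤a v = subst₂ (λ z u → dev p q a v ≤ z + a * u) (dev-𝟎 p q a)
    (trans (dist-comm v 𝟎) (cong ∣_∣ (⊖-𝟎 v))) (dev-change p q 0≤a v 𝟎)

  dev-self : ∀ {N} (p : ℝ^ N) {a} → a ≡ 0# → ∀ v → dev p p a v ≤ 0#
  dev-self p refl v = ≤-trans (dev-≤ p p ≤-refl v)
      (≤-reflexive (trans (cong₂ _+_ (dist-self p) (R.zeroˡ _)) (R.+-identityˡ 0#)))

  ∙-⊖⊙ : ∀ {N} (r x y : ℝ^ N) a → r ∙ (x ⊖ a ⊙ y) ≡ r ∙ x - a * (r ∙ y)
  ∙-⊖⊙ []       []       []       a = solve 1 (λ a → :0 := :0 :- a :* :0) refl a
  ∙-⊖⊙ (r ∷ rs) (x ∷ xs) (y ∷ ys) a = trans (cong (r * (x - a * y) +_) (∙-⊖⊙ rs xs ys a))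
    (solve 6 (λ r x y a p q → r :* (x :- a :* y) :+ (p :- a :* q) := (r :* x :+ p) :- a :*
        (r :* y :+ q)) refl r x y a (rs ∙ xs) (rs ∙ ys))

  ·ᵥ-⊖⊙ : ∀ {M N} (A : Matrix M N) x y a → A ·ᵥ (x ⊖ a ⊙ y) ≡ A ·ᵥ x ⊖ a ⊙ A ·ᵥ y
  ·ᵥ-⊖⊙ []      x y a = refl
  ·ᵥ-⊖⊙ (r ∷ A) x y a = cong₂ _∷_ (∙-⊖⊙ r x y a) (·ᵥ-⊖⊙ A x y a)

  abs-∙ : ∀ {N} (x y : ℝ^ N) → abs (x ∙ y) ≤ ∣ x ∣ * ∣ y ∣
  abs-∙ x y = abs-≤ (cauchy-schwarz x y)
    (subst₂ _≤_ (trans (∙-⊙ˡ (- 1#) x y) (RP.-1*x≈-x _)) (cong (_* ∣ y ∣) (norm-neg x))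
        (cauchy-schwarz ((- 1#) ⊙ x) y))

  -- The sum of the norms of the rows, each contributing by Cauchy-Schwarz, stands in for the
  -- operator norm.
  ·ᵥ-bounded : ∀ {M N} (A : Matrix M N) → ∃ λ c → 0# ≤ c × (∀ x → ∣ A ·ᵥ x ∣ ≤ c * ∣ x ∣)
  ·ᵥ-bounded []      = 0# , ≤-refl , λ x → norm-≤ [] (≤-refl ⊠ norm-nonneg x) (x*x≥0 _)
  ·ᵥ-bounded (r ∷ A) with ·ᵥ-bounded A
  ... | c , 0≤c , bound = ∣ r ∣ + c , norm-nonneg r ⊞ 0≤c , λ x →
    ≤-trans (norm-∷ (r ∙ x) (A ·ᵥ x))
        (subst (abs (r ∙ x) + ∣ A ·ᵥ x ∣ ≤_) (sym (R.distribʳ ∣ x ∣ ∣ r ∣ c))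
      (+-mono-≤ (abs-∙ r x) (bound x)))

  -- Derivatives and the mean value inequality

  telescope : ∀ p q r → (q - p) + (r - q) ≡ r - p
  telescope = solve 3 (λ p q r → (q :- p) :+ (r :- q) := r :- p) refl

  -- c is an endpoint of [p , q] ⊆ [a , b] and q - p ≤ δ.
  record Touching (a b c δ p q : ℝ) : Set where
    constructor touching
    field
      a≤p : a ≤ p
      p≤q : p ≤ q
      q≤b : q ≤ b
      end : p ≡ c ⊎ q ≡ c
      q-p≤δ : q - p ≤ δ

    near : ∀ {r} → p ≤ r → r ≤ q → abs (r - c) ≤ q - p
    near {r} p≤r r≤q with end
    ... | inj₁ refl = abs-≤
      (certify (gap r≤q) (solve 3 (λ p q r → q :- p := r :- p :+ (q :- r)) refl p q r))
      (certify (gap p≤r ⊞ gap p≤q)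
        (solve 3 (λ p q r → q :- p := (:- (r :- p)) :+ (r :- p :+ (q :- p))) refl p q r))
    ... | inj₂ refl = abs-≤
      (certify (gap r≤q ⊞ gap p≤q)
        (solve 3 (λ p q r → q :- p := r :- q :+ (q :- r :+ (q :- p))) refl p q r))
      (certify (gap p≤r) (solve 3 (λ p q r → q :- p := (:- (r :- q)) :+ (r :- p)) refl p q r))

  open Touching using (near)

  widen : ∀ {a a′ b b′ c δ δ′ p q} → a′ ≤ a → b ≤ b′ → δ ≤ δ′ → Touching a b c δ p q →
    Touching a′ b′ c δ′ p q
  widen a′≤a b≤b′ δ≤δ′ (touching a≤p p≤q q≤b end q-p≤δ) =
    touching (≤-trans a′≤a a≤p) p≤q (≤-trans q≤b b≤b′) end (≤-trans q-p≤δ δ≤δ′)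

  -- The points reachable from `a` have a supremum `c`. An interval `[s , c]` shows that `c` itself
  -- is reachable, and if `c < b` an interval `[c , c + m]` leads beyond it. This is Cousin's
  -- covering argument; in its uses `R` is an estimate additive over adjacent intervals, and local
  -- bounds become global ones.
  cousin : (R : ℝ → ℝ → Set) → (∀ {s m t} → R s m → R m t → R s t) → ∀ {a b} → a ≤ b →
           (∀ c → a ≤ c → c ≤ b → ∃ λ δ → 0# < δ × (∀ {p q} → Touching a b c δ p q → R p q)) →
           R a b
  cousin R R-trans {a} {b} a≤b local = subst (R a) c≡b Rac
    where
    S : Pred ℝ 0ℓ
    S s = a ≤ s × s ≤ b × R a s

    x-x≤ : ∀ {x δ} → 0# < δ → x - x ≤ δ
    x-x≤ {x} 0<δ = subst (_≤ _) (sym (R.-‿inverseʳ x)) (<⇒≤ 0<δ)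

    Raa : R a a
    Raa = let δ , 0<δ , Rpq = local a ≤-refl a≤b in Rpq
        (touching ≤-refl ≤-refl a≤b (inj₁ refl) (x-x≤ 0<δ))

    supremum = complete S (a , ≤-refl , a≤b , Raa) (b , λ _ x∈S → proj₁ (proj₂ x∈S))
    c = proj₁ supremum
    ub = proj₁ (proj₂ supremum)
    lub = proj₂ (proj₂ supremum)

    a≤c : a ≤ c
    a≤c = ub a (≤-refl , a≤b , Raa)

    c≤b : c ≤ b
    c≤b = lub b (λ _ x∈S → proj₁ (proj₂ x∈S))

    δ = proj₁ (local c a≤c c≤b)
    0<δ = proj₁ (proj₂ (local c a≤c c≤b))
    Rpq : ∀ {p q} → Touching a b c δ p q → R p q
    Rpq = proj₂ (proj₂ (local c a≤c c≤b))

    Rac : R a c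
    Rac with em {∃ λ s → s ∈ S × c - δ ≤ s}
    ... | yes (s , s∈S@(a≤s , s≤b , Ras) , c-δ≤s) = R-trans Ras
          (Rpq (touching a≤s (ub s s∈S) c≤b (inj₂ refl)
            (certify (gap c-δ≤s) (solve 3 (λ c δ s → δ := c :- s :+ (s :- (c :- δ))) refl c δ s))))
    ... | no ∄s = ⊥-elim (<⇒≱
          (certify< 0<δ (solve 2 (λ c δ → c := c :- δ :+ δ) refl c δ))
          (lub (c - δ) λ s s∈S → <⇒≤ (≰⇒> λ c-δ≤s → ∄s (s , s∈S , c-δ≤s))))

    b≤c : b ≤ c
    b≤c = ≮⇒≥ λ c<b →
      let m , 0<m , m≤δ , m≤b-c = smaller 0<δ (gap< c<b)
          c≤c+m = certify (<⇒≤ 0<m) refl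
          c+m≤b = certify (gap m≤b-c) (solve 3 (λ b c m → b := c :+ m :+ (b :- c :- m)) refl b c m)
          c+m-c≤δ = certify (gap m≤δ) (solve 3 (λ c m δ → δ := c :+ m :- c :+ (δ :- m)) refl c m δ)
      in <⇒≱ (certify< 0<m refl) (ub (c + m) (≤-trans a≤c c≤c+m , c+m≤b ,
           R-trans Rac (Rpq (touching a≤c c≤c+m c+m≤b (inj₁ refl) c+m-c≤δ))))

    c≡b : c ≡ b
    c≡b = ≤-antisym c≤b b≤c

  dev-glue : ∀ {N} (γ : ℝ → ℝ^ N) v p q r →
             dev (γ p) (γ r) (r - p) v ≤ dev (γ p) (γ q) (q - p) v + dev (γ q) (γ r) (r - q) v
  dev-glue γ v p q r = subst (λ a → dev (γ p) (γ r) a v ≤ dev (γ p) (γ q) (q - p) v + dev (γ q)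
      (γ r) (r - q) v)
    (telescope p q r) (dev-trans (γ p) (γ q) (γ r) (q - p) (r - q) v)

  -- The derivative of γ at c relative to [a , b], in straddle form.
  Derivative : ∀ {N} → (ℝ → ℝ^ N) → ℝ → ℝ → ℝ → ℝ^ N → Set
  Derivative γ a b c w = ∀ ε → 0# < ε → ∃ λ δ → 0# < δ ×
    (∀ {p q} → Touching a b c δ p q → dev (γ p) (γ q) (q - p) w ≤ (q - p) * ε)

  HasDerivativeAt⇒Derivative : ∀ {N} {γ : ℝ → ℝ^ N} {c w} a b → HasDerivativeAt γ c w →
    Derivative γ a b c w
  -- Halving turns the weak length bound of `Touching` into the strict one of `HasDerivativeAt`.
  HasDerivativeAt⇒Derivative {γ = γ} {c} {w} a b γ′ ε 0<ε = ½ * δ , 0<½* 0<δ , λ {p} {q} → go p q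
    where
    δ = proj₁ (γ′ ε 0<ε)
    0<δ = proj₁ (proj₂ (γ′ ε 0<ε))
    bound = proj₂ (proj₂ (γ′ ε 0<ε))

    at : ∀ r → abs (r - c) ≤ ½ * δ → dev (γ c) (γ r) (r - c) w ≤ ε * abs (r - c)
    at r r-c≤ = subst (λ s → dev (γ c) (γ s) (r - c) w ≤ ε * abs (r - c))
        (solve 2 (λ c r → c :+ (r :- c) := r) refl c r)
      (bound (r - c) (≤-<-trans r-c≤ (½*< 0<δ)))

    go : ∀ p q → Touching a b c (½ * δ) p q → dev (γ p) (γ q) (q - p) w ≤ (q - p) * ε
    go p q t@(touching _ p≤q _ (inj₁ refl) d) = subst (dev (γ p) (γ q) (q - p) w ≤_)
      (trans (R.*-comm ε _) (cong (_* ε) (nonneg⇒abs (gap p≤q))))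
          (at q (≤-trans (near t p≤q ≤-refl) d))
    go p q t@(touching _ p≤q _ (inj₂ refl) d) = subst₂ _≤_ (dev-sym (γ p) (γ q) q p w)
      (trans (R.*-comm ε _) (cong (_* ε)
          (trans (sym (abs-neg (p - q)))
          (trans (cong abs (solve 2 (λ p q → :- (p :- q) := q :- p) refl p q))
          (nonneg⇒abs (gap p≤q))))))
      (at p (≤-trans (near t ≤-refl p≤q) d))

  Derivative⇒HasDerivativeAt : ∀ {N} {γ : ℝ → ℝ^ N} {a b c w} → a < c → c < b →
    Derivative γ a b c w → HasDerivativeAt γ c w
  Derivative⇒HasDerivativeAt {γ = γ} {a} {b} {c} {w} a<c c<b γ′ ε 0<ε =
    let δ₀ , 0<δ₀ , bound = γ′ ε 0<ε
        m , 0<m , m≤c-a , m≤b-c = smaller (gap< a<c) (gap< c<b)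
        δ , 0<δ , δ≤δ₀ , δ≤m = smaller 0<δ₀ 0<m
    in δ , 0<δ , λ h (∣h∣≤δ , _) →
      [ (λ 0≤h → let h≤δ = subst (_≤ δ) (nonneg⇒abs 0≤h) ∣h∣≤δ in
          right h 0≤h (bound (touching (<⇒≤ a<c) (certify 0≤h refl)
            (certify (gap m≤b-c ⊞ gap δ≤m ⊞ gap h≤δ)
                (solve 5 (λ b c h m δ →
                b := c :+ h :+ (b :- c :- m :+ (m :- δ) :+ (δ :- h))) refl b c h m δ))
            (inj₁ refl)
            (certify (gap h≤δ ⊞ gap δ≤δ₀)
                (solve 4 (λ c h δ δ₀ →
                δ₀ := c :+ h :- c :+ (δ :- h :+ (δ₀ :- δ))) refl c h δ δ₀)))))
      , (λ h≤0 → let -h≤δ = subst (_≤ δ) (nonpos⇒abs h≤0) ∣h∣≤δ in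
          left h h≤0 (bound (touching
            (certify (gap m≤c-a ⊞ gap δ≤m ⊞ gap -h≤δ)
                (solve 5 (λ a c h m δ →
                c :+ h := a :+ (c :- a :- m :+ (m :- δ) :+ (δ :- (:- h)))) refl a c h m δ))
            (certify (gap h≤0) (solve 2 (λ c h → c := c :+ h :+ (:0 :- h)) refl c h))
            (<⇒≤ c<b) (inj₂ refl)
            (certify (gap -h≤δ ⊞ gap δ≤δ₀)
                (solve 4 (λ c h δ δ₀ →
                δ₀ := c :- (c :+ h) :+ (δ :- (:- h) :+ (δ₀ :- δ))) refl c h δ δ₀)))))
      ]′ (≤-total 0# h)
    where
    right : ∀ h → 0# ≤ h → dev (γ c) (γ (c + h)) (c + h - c) w ≤ (c + h - c) * ε →
            dev (γ c) (γ (c + h)) h w ≤ ε * abs h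
    right h 0≤h = subst₂ (λ k l → dev (γ c) (γ (c + h)) k w ≤ l) c+h-c≡h
      (trans (R.*-comm (c + h - c) ε) (cong (ε *_) (trans c+h-c≡h (sym (nonneg⇒abs 0≤h)))))
      where
      c+h-c≡h : c + h - c ≡ h
      c+h-c≡h = solve 2 (λ c h → c :+ h :- c := h) refl c h

    left : ∀ h → h ≤ 0# → dev (γ (c + h)) (γ c) (c - (c + h)) w ≤ (c - (c + h)) * ε →
           dev (γ c) (γ (c + h)) h w ≤ ε * abs h
    left h h≤0 = subst₂ _≤_
      (trans (dev-sym (γ c) (γ (c + h)) (c + h) c w)
          (cong (λ k → dev (γ c) (γ (c + h)) k w) (solve 2 (λ c h → c :+ h :- c := h) refl c h)))
      (trans (solve 3 (λ c h ε → (c :- (c :+ h)) :* ε := ε :* (:- h)) refl c h ε)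
          (cong (ε *_) (sym (nonpos⇒abs h≤0))))

  -- For a continuous γ on [a , b] this is equivalent to γ′ = F ∘ γ; it passes to
  -- subintervals and to concatenations without any differentiation at the junction.
  MeanValue : ∀ {N} → (ℝ^ N → ℝ^ N) → (ℝ → ℝ^ N) → ℝ → ℝ → Set
  MeanValue F γ a b = ∀ v ε {s s′} → a ≤ s → s ≤ s′ → s′ ≤ b →
    (∀ r → s ≤ r → r ≤ s′ → ∣ F (γ r) ⊖ v ∣ ≤ ε) → dev (γ s) (γ s′) (s′ - s) v ≤ (s′ - s) * ε

  +-*-glue : ∀ p q r k → (q - p) * k + (r - q) * k ≡ (r - p) * k
  +-*-glue p q r k = trans (sym (R.distribʳ k _ _)) (cong (_* k) (telescope p q r))

  -- Near `c` the curve moves with velocity `F (γ c)` up to `η`, and this velocity is within `ε` of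
  -- `v`. The bound with `ε + η` is additive over intervals, so `cousin` spreads it to all of
  -- `[s , s′]`, and `η` tends to 0.
  derivatives⇒mean-value : ∀ {N} {F : ℝ^ N → ℝ^ N} {γ : ℝ → ℝ^ N} {s s′} → s ≤ s′ →
    (∀ c → s ≤ c → c ≤ s′ → Derivative γ s s′ c (F (γ c))) →
    ∀ v ε → (∀ r → s ≤ r → r ≤ s′ → ∣ F (γ r) ⊖ v ∣ ≤ ε) →
        dev (γ s) (γ s′) (s′ - s) v ≤ (s′ - s) * ε
  derivatives⇒mean-value {F = F} {γ} {s} {s′} s≤s′ γ′ v ε Fγ≈v = ≤-limit (gap s≤s′) λ η 0<η →
    subst (dev (γ s) (γ s′) (s′ - s) v ≤_)
        (solve 3 (λ h ε η → h :* (ε :+ η) := h :* ε :+ η :* h) refl (s′ - s) ε η)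
      (cousin (λ p q → dev (γ p) (γ q) (q - p) v ≤ (q - p) * (ε + η))
        (λ {p} {q} {r} pq qr → ≤-trans (dev-glue γ v p q r)
            (subst (dev (γ p) (γ q) (q - p) v + dev (γ q) (γ r) (r - q) v ≤_)
            (+-*-glue p q r (ε + η)) (+-mono-≤ pq qr)))
        s≤s′ (λ c s≤c c≤s′ →
          let δ , 0<δ , bound = γ′ c s≤c c≤s′ η 0<η
          in δ , 0<δ , λ {p} {q} t →
          ≤-trans (dev-change (γ p) (γ q) (gap (Touching.p≤q t)) v (F (γ c)))
            (≤-trans (+-mono-≤ (bound t) (*-monoˡ-≤ (gap (Touching.p≤q t)) (Fγ≈v c s≤c c≤s′)))
              (≤-reflexive (solve 4
                  (λ p q ε η → (q :- p) :* η :+ (q :- p) :* ε := (q :- p) :*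
                  (ε :+ η)) refl p q ε η)))))

  -- For the ends of an integral curve, where only continuity is given. The bound `η` is not
  -- proportional to the length of `[p , q]`, so it can be spent on a fixed number of intervals but
  -- not summed by `cousin`.
  continuity-straddle : ∀ {N} {γ : ℝ → ℝ^ N} {a b} → ContinuousOn a b γ → ∀ {c} → a ≤ c → c ≤ b →
    ∀ v η → 0# < η →
    ∃ λ δ → 0# < δ × (∀ {p q} → Touching a b c δ p q → dev (γ p) (γ q) (q - p) v ≤ η)
  continuity-straddle {γ = γ} {a} {b} cont {c} a≤c c≤b v η 0<η = δ , 0<δ , go
    where
    modulus = cont c a≤c c≤b (½ * η) (0<½* 0<η)
    scale = scaled-below (0<½* 0<η) (norm-nonneg v)
    0<δ₁ = proj₁ (proj₂ modulus)
    close = proj₂ (proj₂ modulus)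
    δ₂v≤ = proj₂ (proj₂ scale)
    minimum = smaller (0<½* 0<δ₁) (proj₁ (proj₂ scale))
    δ = proj₁ minimum
    0<δ = proj₁ (proj₂ minimum)
    δ≤½δ₁ = proj₁ (proj₂ (proj₂ minimum))
    δ≤δ₂ = proj₂ (proj₂ (proj₂ minimum))

    dist : ∀ {p q} → Touching a b c δ p q → ∣ γ q ⊖ γ p ∣ ≤ ½ * η
    dist {p} {q} t@(touching a≤p p≤q q≤b (inj₁ refl) d) = <⇒≤ (close q (≤-trans a≤p p≤q) q≤b
      (≤-<-trans (≤-trans (near t p≤q ≤-refl) (≤-trans d δ≤½δ₁)) (½*< 0<δ₁)))
    dist {p} {q} t@(touching a≤p p≤q q≤b (inj₂ refl) d) = subst (_≤ ½ * η) (dist-comm (γ q) (γ p))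
        (<⇒≤ (close p a≤p (≤-trans p≤q q≤b)
      (≤-<-trans (≤-trans (near t ≤-refl p≤q) (≤-trans d δ≤½δ₁)) (½*< 0<δ₁))))

    go : ∀ {p q} → Touching a b c δ p q → dev (γ p) (γ q) (q - p) v ≤ η
    go {p} {q} t@(touching _ p≤q _ _ d) = ≤-trans (dev-≤ (γ p) (γ q) (gap p≤q) v)
      (subst (∣ γ q ⊖ γ p ∣ + (q - p) * ∣ v ∣ ≤_) (½x+½x η)
          (+-mono-≤ (dist t) (≤-trans (*-monoʳ-≤ (norm-nonneg v) (≤-trans d δ≤δ₂)) δ₂v≤)))

  -- Derivatives are given only in the open interval. Pieces of length `d` and `e` are therefore cut
  -- off at `s` and `s′`; each costs `η` by continuity, and what remains lies strictly between `a`
  -- and `b`.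
  integral-curve⇒mean-value : ∀ {N} {F : ℝ^ N → ℝ^ N} {γ : ℝ → ℝ^ N} {a b} →
    IsIntegralCurve F a b γ → MeanValue F γ a b
  integral-curve⇒mean-value {F = F} {γ} {a} {b} (cont , γ′) v ε {s} {s′} a≤s s≤s′ s′≤b Fγ≈v =
    [ degenerate , proper ]′ (≤-total-strict s′ s)
    where
    degenerate : s′ ≤ s → dev (γ s) (γ s′) (s′ - s) v ≤ (s′ - s) * ε
    degenerate s′≤s = ≤-trans (subst (λ r → dev (γ s) (γ r) (r - s) v ≤ 0#) s≡s′
        (dev-self (γ s) (R.-‿inverseʳ s) v))
      (gap s≤s′ ⊠ ≤-trans (norm-nonneg (F (γ s) ⊖ v)) (Fγ≈v s ≤-refl s≤s′))
      where
      s≡s′ = ≤-antisym s≤s′ s′≤s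

    proper : s < s′ → dev (γ s) (γ s′) (s′ - s) v ≤ (s′ - s) * ε
    proper s<s′ = ≤-limit (0≤1 ⊞ 0≤1) λ η 0<η →
      let 0<½ℓ = 0<½* (gap< s<s′)
          δ₁ , 0<δ₁ , near-s  = continuity-straddle {γ = γ} cont a≤s (≤-trans s≤s′ s′≤b) v η 0<η
          δ₂ , 0<δ₂ , near-s′ = continuity-straddle {γ = γ} cont (≤-trans a≤s s≤s′) s′≤b v η 0<η
          d , 0<d , d≤δ₁ , d≤½ℓ = smaller 0<δ₁ 0<½ℓ
          e , 0<e , e≤δ₂ , e≤½ℓ = smaller 0<δ₂ 0<½ℓ
          p = s + d
          q = s′ - e
          s<p = certify< {s} {p} 0<d refl
          q<s′ = certify< {q} {s′} 0<e (solve 2 (λ s e → s := s :- e :+ e) refl s′ e)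
          p≤q = certify {p} {q} (gap d≤½ℓ ⊞ gap e≤½ℓ) (≡-via (sym (½x+½x (s′ - s)))
            (solve 5 (λ s s′ d e h → s′ :- e :+ (h :+ h) :=
                s :+ d :+ (h :- d :+ (h :- e)) :+ (s′ :- s)) refl s s′ d e (½ * (s′ - s))))
          a≤p = ≤-trans a≤s (<⇒≤ s<p)
          q≤b = ≤-trans (<⇒≤ q<s′) s′≤b
          0≤ε = ≤-trans (norm-nonneg (F (γ s) ⊖ v)) (Fγ≈v s ≤-refl s≤s′)
          sp = near-s (touching a≤s (<⇒≤ s<p) (≤-trans p≤q q≤b) (inj₁ refl)
              (certify (gap d≤δ₁) (solve 3 (λ s d δ → δ := s :+ d :- s :+ (δ :- d)) refl s d δ₁)))
          qs′ = near-s′ (touching (≤-trans a≤p p≤q) (<⇒≤ q<s′) s′≤b (inj₂ refl)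
              (certify (gap e≤δ₂) (solve 3 (λ s e δ →
              δ := s :- (s :- e) :+ (δ :- e)) refl s′ e δ₂)))
          pq = derivatives⇒mean-value {F = F} {γ} p≤q
              (λ c p≤c c≤q → HasDerivativeAt⇒Derivative {γ = γ} p q
              (γ′ c (≤-<-trans a≤s (<-≤-trans s<p p≤c)) (<-≤-trans (≤-<-trans c≤q q<s′) s′≤b)))
                 v ε (λ r p≤r r≤q → Fγ≈v r (≤-trans (<⇒≤ s<p) p≤r) (≤-trans r≤q (<⇒≤ q<s′)))
      in ≤-trans (dev-glue γ v s p s′)
              (≤-trans (+-mono-≤ sp (≤-trans (dev-glue γ v p q s′) (+-mono-≤ pq qs′)))
           (certify ((<⇒≤ 0<d ⊞ <⇒≤ 0<e) ⊠ 0≤ε) (solve 6 (λ s s′ d e ε η →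
              (s′ :- s) :* ε :+ η :* :2 := (η :+ ((s′ :- e :- (s :+ d)) :* ε :+ η)) :+
                  (d :+ e) :* ε) refl s s′ d e ε η)))

  ⊕-⊖ : ∀ {N} (x y : ℝ^ N) → x ⊕ (y ⊖ x) ≡ y
  ⊕-⊖ []       []       = refl
  ⊕-⊖ (x ∷ xs) (y ∷ ys) = cong₂ _∷_ (solve 2 (λ x y → x :+ (y :- x) := y) refl x y) (⊕-⊖ xs ys)

  jacobian-at : ∀ {M N} {f : ℝ^ M → ℝ^ N} {x A} → HasJacobianAt f x A → ∀ ε → 0# < ε →
    ∃ λ δ → 0# < δ ×
    (∀ y → ∣ y ⊖ x ∣ ≤ δ → ∣ f y ⊖ f x ⊖ A ·ᵥ (y ⊖ x) ∣ ≤ ε * ∣ y ⊖ x ∣)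
  jacobian-at {f = f} {x} {A} J ε 0<ε = let δ , 0<δ , bound = J ε 0<ε in
    ½ * δ , 0<½* 0<δ , λ y d → subst (λ z → ∣ f z ⊖ f x ⊖ A ·ᵥ (y ⊖ x) ∣ ≤ ε * ∣ y ⊖ x ∣) (⊕-⊖ x y)
        (bound (y ⊖ x) (≤-<-trans d (½*< 0<δ)))

  norm-≤-⊖+norm : ∀ {N} (x y : ℝ^ N) → ∣ x ∣ ≤ ∣ x ⊖ y ∣ + ∣ y ∣
  norm-≤-⊖+norm x y = subst₂ (λ u v → ∣ u ∣ ≤ ∣ x ⊖ y ∣ + ∣ v ∣) (⊖-𝟎 x) (⊖-𝟎 y)
      (dist-triangle x y 𝟎)

  ContinuousAt : ∀ {M N} → (ℝ^ M → ℝ^ N) → ℝ^ M → Set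
  ContinuousAt f x = ∀ ε → 0# < ε → ∃ λ δ → 0# < δ × (∀ y → ∣ y ⊖ x ∣ ≤ δ → ∣ f y ⊖ f x ∣ ≤ ε)

  -- Linearised with the error factor 1, `f` satisfies `∣ f y ⊖ f x ∣ ≤ (1 + c) ∣ y ⊖ x ∣` near `x`,
  -- where `c` bounds `A`.
  jacobian⇒continuous : ∀ {M N} {f : ℝ^ M → ℝ^ N} {x A} → HasJacobianAt f x A → ContinuousAt f x
  jacobian⇒continuous {f = f} {x} {A} J ε 0<ε =
    let δ₁ , 0<δ₁ , linear = jacobian-at {f = f} {x} {A} J 1# 0<1
        c , 0≤c , A-bound = ·ᵥ-bounded A
        δ₂ , 0<δ₂ , δ₂c≤ε = scaled-below 0<ε (0≤1 ⊞ 0≤c)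
        δ , 0<δ , δ≤δ₁ , δ≤δ₂ = smaller 0<δ₁ 0<δ₂
    in δ , 0<δ , λ y d → ≤-trans (norm-≤-⊖+norm (f y ⊖ f x) (A ·ᵥ (y ⊖ x)))
         (≤-trans (+-mono-≤ (linear y (≤-trans d δ≤δ₁)) (A-bound (y ⊖ x)))
           (certify (gap δ₂c≤ε ⊞ gap (≤-trans d δ≤δ₂) ⊠ (0≤1 ⊞ 0≤c))
             (solve 4 (λ n c ε δ → ε :=
                 :1 :* n :+ c :* n :+
                 (ε :- δ :* (:1 :+ c) :+ (δ :- n) :* (:1 :+ c))) refl ∣ y ⊖ x ∣ c ε δ₂)))

  -- First and second order estimates along a curve

  module _ {N} (F : ℝ^ N → ℝ^ N) (γ : ℝ → ℝ^ N) {a b : ℝ} (mean : MeanValue F γ a b) where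

    lipschitz : ∀ {L} → (∀ r → a ≤ r → r ≤ b → ∣ F (γ r) ∣ ≤ L) →
                ∀ {s s′} → a ≤ s → s ≤ s′ → s′ ≤ b → ∣ γ s′ ⊖ γ s ∣ ≤ (s′ - s) * L
    lipschitz {L} bound {s} {s′} a≤s s≤s′ s′≤b = subst (_≤ (s′ - s) * L)
        (dev-𝟎 (γ s) (γ s′) (s′ - s))
      (mean 𝟎 L a≤s s≤s′ s′≤b λ r s≤r r≤s′ → subst (λ z → ∣ z ∣ ≤ L) (sym (⊖-𝟎 (F (γ r))))
          (bound r (≤-trans a≤s s≤r) (≤-trans r≤s′ s′≤b)))

    lipschitz-abs : ∀ {L} → (∀ r → a ≤ r → r ≤ b → ∣ F (γ r) ∣ ≤ L) →
                    ∀ {s r} → a ≤ s → s ≤ b → a ≤ r → r ≤ b → ∣ γ r ⊖ γ s ∣ ≤ abs (r - s) * L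
    lipschitz-abs {L} bound {s} {r} a≤s s≤b a≤r r≤b =
      [ (λ s≤r → subst (λ d → ∣ γ r ⊖ γ s ∣ ≤ d * L) (sym (nonneg⇒abs (gap s≤r)))
          (lipschitz bound a≤s s≤r r≤b))
      , (λ r≤s → subst₂ (λ n d → n ≤ d * L) (dist-comm (γ r) (γ s))
          (trans (sym (nonneg⇒abs (gap r≤s))) (abs-sym r s)) (lipschitz bound a≤r r≤s s≤b))
      ]′ (≤-total s r)
      where
      abs-sym : ∀ r s → abs (s - r) ≡ abs (r - s)
      abs-sym r s = trans (cong abs (solve 2 (λ r s → s :- r := :- (r :- s)) refl r s))
          (abs-neg (r - s))

    module _ {L} (bound : ∀ r → a ≤ r → r ≤ b → ∣ F (γ r) ∣ ≤ L) (0≤L : 0# ≤ L) where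

      -- On a short interval at `c` the Lipschitz bound keeps the curve in the ball where `F` is
      -- within `ε` of `F (γ c)`. The one-sided cases at `a` and `b` are included, since
      -- `acceleration` works on closed intervals.
      mean-value⇒Derivative : ∀ {c} → a ≤ c → c ≤ b → ContinuousAt F (γ c) →
        Derivative γ a b c (F (γ c))
      mean-value⇒Derivative {c} a≤c c≤b F-cont ε 0<ε =
        let δ₁ , 0<δ₁ , close = F-cont ε 0<ε
            δ , 0<δ , δL≤δ₁ = scaled-below 0<δ₁ 0≤L
        in δ , 0<δ , λ t@(touching a≤p p≤q q≤b _ q-p≤δ) →
          mean (F (γ c)) ε a≤p p≤q q≤b λ r p≤r r≤q →
            close (γ r) (≤-trans (lipschitz-abs bound a≤c c≤b (≤-trans a≤p p≤r) (≤-trans r≤q q≤b))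
              (≤-trans (*-monoʳ-≤ 0≤L (≤-trans (near t p≤r r≤q) q-p≤δ)) δL≤δ₁))

      mean-value⇒integral-curve : (∀ x → ContinuousAt F x) → IsIntegralCurve F a b γ
      mean-value⇒integral-curve F-cont = continuous , λ s a<s s<b →
        Derivative⇒HasDerivativeAt {γ = γ} a<s s<b
            (mean-value⇒Derivative (<⇒≤ a<s) (<⇒≤ s<b) (F-cont (γ s)))
        where
        continuous : ContinuousOn a b γ
        continuous s a≤s s≤b ε 0<ε =
          let δ , 0<δ , δL≤ = scaled-below (0<½* 0<ε) 0≤L
          in δ , 0<δ , λ r a≤r r≤b d → ≤-<-trans (≤-trans (lipschitz-abs bound a≤s s≤b a≤r r≤b)
               (≤-trans (*-monoʳ-≤ 0≤L (<⇒≤ d)) δL≤)) (½*< 0<ε)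

      module _ {D : ℝ^ N → Matrix N N} (jac : ∀ x → HasJacobianAt F x (D x))
               {M} (DF-bound : ∀ r → a ≤ r → r ≤ b → ∣ D (γ r) ·ᵥ F (γ r) ∣ ≤ M) where

        private
          -- The chain rule for `F ∘ γ` at `c`, as an estimate: `x ⊖ γ c` is `d ⊙ F (γ c)` up to
          -- `h η`, and the Jacobian maps this main term to norm at most `h M`. The errors are
          -- `η h L` from linearising `F` and `C h η` from the deviation of the curve. The step `d`
          -- carries a sign and `h` bounds its size, so both sides of `c` are served.
          jacobian-step : ∀ {c} → a ≤ c → c ≤ b → ∀ {x h d η C} → 0# ≤ h → 0# ≤ C → 0# ≤ η →
            abs d ≤ h →
            (∀ y → ∣ D (γ c) ·ᵥ y ∣ ≤ C * ∣ y ∣) →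
            ∣ x ⊖ γ c ∣ ≤ h * L → dev (γ c) x d (F (γ c)) ≤ h * η →
            ∣ F x ⊖ F (γ c) ⊖ D (γ c) ·ᵥ (x ⊖ γ c) ∣ ≤ η * ∣ x ⊖ γ c ∣ →
            ∣ F x ⊖ F (γ c) ∣ ≤ h * (M + η * (L + C))
          jacobian-step {c} a≤c c≤b {x} {h} {d} {η} {C} 0≤h 0≤C 0≤η d≤h A-bound x-near x-dev
              linear =
            ≤-trans (norm-≤-⊖+norm (F x ⊖ F (γ c)) (A ·ᵥ (x ⊖ γ c)))
              (≤-trans (+-mono-≤ linear
                  (≤-trans (norm-≤-⊖+norm (A ·ᵥ (x ⊖ γ c)) (d ⊙ A ·ᵥ w)) (+-mono-≤ first second)))
                (certify (gap x-near ⊠ 0≤η) (solve 7 (λ n h η C M L d → h :* (M :+ η :* (L :+ C)) :=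
                  η :* n :+ (C :* (h :* η) :+ h :* M) :+
                      (h :* L :- n) :* η) refl ∣ x ⊖ γ c ∣ h η C M L d)))
            where
            A = D (γ c)
            w = F (γ c)

            first : ∣ A ·ᵥ (x ⊖ γ c) ⊖ d ⊙ A ·ᵥ w ∣ ≤ C * (h * η)
            first = subst (λ z → ∣ z ∣ ≤ C * (h * η)) (·ᵥ-⊖⊙ A (x ⊖ γ c) w d)
              (≤-trans (A-bound (x ⊖ γ c ⊖ d ⊙ w)) (*-monoˡ-≤ 0≤C x-dev))

            second : ∣ d ⊙ A ·ᵥ w ∣ ≤ h * M
            second = subst (_≤ h * M) (sym (norm-⊙ d (A ·ᵥ w)))
              (≤-trans (*-monoʳ-≤ (norm-nonneg (A ·ᵥ w)) d≤h) (*-monoˡ-≤ 0≤h (DF-bound c a≤c c≤b)))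

        -- By `jacobian-step` the local increments of `F ∘ γ` are at most `(q - p) (M + η)`;
        -- `cousin` makes this global, and `η` tends to 0.
        acceleration : ∀ {s s′} → a ≤ s → s ≤ s′ → s′ ≤ b → ∣ F (γ s′) ⊖ F (γ s) ∣ ≤ (s′ - s) * M
        acceleration {s} {s′} a≤s s≤s′ s′≤b = ≤-limit (gap s≤s′) λ η 0<η →
          subst (∣ F (γ s′) ⊖ F (γ s) ∣ ≤_)
              (solve 3 (λ h M η → h :* (M :+ η) := h :* M :+ η :* h) refl (s′ - s) M η)
            (cousin (λ p q → ∣ F (γ q) ⊖ F (γ p) ∣ ≤ (q - p) * (M + η))
              (λ {p} {q} {r} pq qr → ≤-trans (dist-triangle (F (γ r)) (F (γ q)) (F (γ p)))
                (≤-trans (+-mono-≤ qr pq)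
                    (≤-reflexive (trans (R.+-comm _ _) (+-*-glue p q r (M + η))))))
              s≤s′ (local η 0<η))
          where
          local : ∀ η → 0# < η → ∀ c → s ≤ c → c ≤ s′ → ∃ λ δ → 0# < δ ×
                  (∀ {p q} → Touching s s′ c δ p q → ∣ F (γ q) ⊖ F (γ p) ∣ ≤ (q - p) * (M + η))
          local η 0<η c s≤c c≤s′ =
            let a≤c = ≤-trans a≤s s≤c
                c≤b = ≤-trans c≤s′ s′≤b
                C , 0≤C , A-bound = ·ᵥ-bounded (D (γ c))
                -- `η′` absorbs the factor `L + C` of the chain rule error; `δ₃` keeps the curve in
                -- the ball of radius `δ₁` where the linearisation is valid.
                η′ , 0<η′ , η′[L+C]≤η = scaled-below 0<η (0≤L ⊞ 0≤C)
                δ₁ , 0<δ₁ , linear = jacobian-at {f = F} {γ c} {D (γ c)} (jac (γ c)) η′ 0<η′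
                δ₂ , 0<δ₂ , γ′ = mean-value⇒Derivative a≤c c≤b
                    (jacobian⇒continuous {f = F} {γ c} {D (γ c)} (jac (γ c))) η′ 0<η′
                δ₃ , 0<δ₃ , δ₃L≤δ₁ = scaled-below 0<δ₁ 0≤L
                δ , 0<δ , δ≤δ₂ , δ≤δ₃ = smaller 0<δ₂ 0<δ₃
                close : ∀ {p q} → Touching s s′ c δ p q → (q - p) * L ≤ δ₁
                close t = ≤-trans (*-monoʳ-≤ 0≤L (≤-trans (Touching.q-p≤δ t) δ≤δ₃)) δ₃L≤δ₁
                grow : ∀ {p q} → Touching s s′ c δ p q →
                  (q - p) * (M + η′ * (L + C)) ≤ (q - p) * (M + η)
                grow t = *-monoˡ-≤ (gap (Touching.p≤q t)) (+-mono-≤ ≤-refl η′[L+C]≤η)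
            in δ , 0<δ , λ
              { {p} {q} t@(touching _ p≤q q≤s′ (inj₁ refl) _) →
                  let n = lipschitz bound a≤c p≤q (≤-trans q≤s′ s′≤b) in
                  ≤-trans (jacobian-step a≤c c≤b {γ q} (gap p≤q) 0≤C (<⇒≤ 0<η′)
                    (≤-reflexive (nonneg⇒abs (gap p≤q))) A-bound n (γ′ (widen a≤s s′≤b δ≤δ₂ t))
                    (linear (γ q) (≤-trans n (close t)))) (grow t)
              ; {p} {q} t@(touching s≤p p≤q _ (inj₂ refl) _) →
                  let n = subst (_≤ (q - p) * L) (dist-comm (γ p) (γ q))
                          (lipschitz bound (≤-trans a≤s s≤p) p≤q c≤b) in
                  subst (_≤ (q - p) * (M + η)) (dist-comm (F (γ q)) (F (γ p)))
                    (≤-trans (jacobian-step a≤c c≤b {γ p} {d = p - q} (gap p≤q) 0≤C (<⇒≤ 0<η′)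
                      (≤-reflexive (trans (sym (abs-neg (p - q)))
                          (trans (cong abs (solve 2 (λ p q → :- (p :- q) := q :- p) refl p q))
                          (nonneg⇒abs (gap p≤q)))))
                      A-bound n (subst (_≤ (q - p) * η′) (dev-sym (γ q) (γ p) p q (F (γ q)))
                          (γ′ (widen a≤s s′≤b δ≤δ₂ t)))
                      (linear (γ p) (≤-trans n (close t)))) (grow t))
              }

    module _ {M} (0≤M : 0# ≤ M)
        (accel : ∀ {s s′} → a ≤ s → s ≤ s′ → s′ ≤ b → ∣ F (γ s′) ⊖ F (γ s) ∣ ≤ (s′ - s) * M) where

      private
        s+h-s≡h : ∀ s h → s + h - s ≡ h
        s+h-s≡h = solve 2 (λ s h → s :+ h :- s := h) refl

        -- Halving the step turns an error c M h² into (c / 2 + 1 / 4) M h², whose fixpoint is c = 1 / 2.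
        second-order-approx : ∀ n {s h} → a ≤ s → 0# ≤ h → s + h ≤ b →
          dev (γ s) (γ (s + h)) h (F (γ s)) ≤ ½ * (h * h) * M + ½ * h * M * hal n h
        second-order-approx zero {s} {h} a≤s 0≤h s+h≤b =
          subst₂ (λ k e → dev (γ s) (γ (s + h)) k (F (γ s)) ≤ e) (s+h-s≡h s h)
            (trans (trans (solve 3 (λ s h M → (s :+ h :- s) :* (h :* M) := h :* h :* M) refl s h M)
                (sym (½x+½x (h * h * M))))
              (solve 3 (λ c h M → c :* (h :* h :* M) :+ c :* (h :* h :* M) :=
                  c :* (h :* h) :* M :+ c :* h :* M :* h) refl ½ h M))
            (mean (F (γ s)) (h * M) a≤s (certify 0≤h refl) s+h≤b λ r s≤r r≤s+h →
              ≤-trans (accel a≤s s≤r (≤-trans r≤s+h s+h≤b))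
                (*-monoʳ-≤ 0≤M (certify (gap r≤s+h)
                    (solve 3 (λ s h r → h := r :- s :+ (s :+ h :- r)) refl s h r))))
        second-order-approx (suc n) {s} {h} a≤s 0≤h s+h≤b =
          subst₂ (λ t l → dev p (γ t) l v ≤ ½ * (h * h) * M + ½ * h * M * hal n k) s+k+k≡s+h
              (½x+½x h)
            (≤-trans (dev-trans p q r k k v) (≤-trans (+-mono-≤ first second) (≤-reflexive total)))
          where
          k = ½ * h
          p = γ s
          q = γ (s + k)
          r = γ (s + k + k)
          v = F p
          E = ½ * (k * k) * M + ½ * k * M * hal n k
          0≤k = 0≤½ ⊠ 0≤h

          s+k+k≡s+h : s + k + k ≡ s + h
          s+k+k≡s+h = trans (R.+-assoc s k k) (cong (s +_) (½x+½x h))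

          s+k+k≤b : s + k + k ≤ b
          s+k+k≤b = subst (_≤ b) (sym s+k+k≡s+h) s+h≤b

          s+k≤b : s + k ≤ b
          s+k≤b = ≤-trans (certify 0≤k refl) s+k+k≤b

          first : dev p q k v ≤ E
          first = second-order-approx n a≤s 0≤k s+k≤b

          -- The second half departs with velocity `F q` where `v` is required. By `accel` the
          -- exchange costs `k (k M)`, which is `M h² / 4`.
          second : dev q r k v ≤ E + k * (k * M)
          second = ≤-trans (dev-change q r 0≤k v (F q)) (+-mono-≤
            (second-order-approx n (≤-trans a≤s (certify 0≤k refl)) 0≤k s+k+k≤b)
            (*-monoˡ-≤ 0≤k (subst (λ d → ∣ F q ⊖ v ∣ ≤ d * M) (s+h-s≡h s k)
                (accel a≤s (certify 0≤k refl) s+k≤b))))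

          total : E + (E + k * (k * M)) ≡ ½ * (h * h) * M + ½ * h * M * hal n k
          total = begin
            E + (E + k * (k * M))              ≡⟨ cong (λ z → E + (E + z)) (½x+½x _) ⟨
            E + (E + (½ * (k * (k * M)) + ½ * (k * (k * M))))
              ≡⟨ solve 4 (λ c k M z →
                   let e = c :* (k :* k) :* M :+ c :* k :* M :* z in
                   e :+ (e :+ (c :* (k :* (k :* M)) :+ c :* (k :* (k :* M)))) :=
                   c :* ((k :+ k) :* (k :+ k)) :* M :+ c :* (k :+ k) :* M :* z) refl ½ k M
                       (hal n k) ⟩
            ½ * ((k + k) * (k + k)) * M + ½ * (k + k) * M * hal n k
              ≡⟨ cong (λ l → ½ * (l * l) * M + ½ * l * M * hal n k) (½x+½x h) ⟩
            ½ * (h * h) * M + ½ * h * M * hal n k ∎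

      second-order : ∀ {s h} → a ≤ s → 0# ≤ h → s + h ≤ b →
        dev (γ s) (γ (s + h)) h (F (γ s)) ≤ ½ * (h * h) * M
      second-order {s} {h} a≤s 0≤h s+h≤b = ≤-hal-limit
          (½ * h * M) h λ n → second-order-approx n a≤s 0≤h s+h≤b

  -- Compactness

  -- On a compact set this suffices for a finite norm, and it passes to `D x ·ᵥ F x` row by row, by
  -- multiplying the local constants.
  LocallyBounded : ∀ {M N} → (ℝ^ M → ℝ^ N) → Set
  LocallyBounded H = ∀ x → ∃ λ δ → 0# < δ × ∃ λ c → ∀ y → ∣ y ⊖ x ∣ ≤ δ → ∣ H y ∣ ≤ c

  continuous⇒locally-bounded : ∀ {M N} {H : ℝ^ M → ℝ^ N} → (∀ x → ContinuousAt H x) →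
    LocallyBounded H
  continuous⇒locally-bounded {H = H} H-cont x = let δ , 0<δ , close = H-cont x 1# 0<1 in
    δ , 0<δ , 1# + ∣ H x ∣ , λ y d → ≤-trans (norm-≤-⊖+norm (H y) (H x))
        (+-mono-≤ (close y d) ≤-refl)

  Continuous⇒ContinuousAt : ∀ {M N} {H : ℝ^ M → ℝ^ N} → Continuous H → ∀ x → ContinuousAt H x
  Continuous⇒ContinuousAt H-cont x ε 0<ε = let δ , 0<δ , close = H-cont x ε 0<ε in
    ½ * δ , 0<½* 0<δ , λ y d → <⇒≤ (close y (≤-<-trans d (½*< 0<δ)))

  ·ᵥ-locally-bounded : ∀ {K M N} {A : ℝ^ K → Matrix M N} {H : ℝ^ K → ℝ^ N} →
    (∀ i → LocallyBounded (λ x → lookup (A x) i)) → LocallyBounded H →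
        LocallyBounded (λ x → A x ·ᵥ H x)
  ·ᵥ-locally-bounded {M = zero} {A = A} {H} _ _ x = 1# , 0<1 , 0# , λ y _ → empty (A y ·ᵥ H y)
    where
    empty : (v : ℝ^ 0) → ∣ v ∣ ≤ 0#
    empty [] = norm-≤ [] ≤-refl (x*x≥0 0#)
  ·ᵥ-locally-bounded {M = suc M} {A = A} {H} rows H-bounded x =
    let δ₁ , 0<δ₁ , c₁ , row₀-bound = rows zero x
        δ₂ , 0<δ₂ , c₂ , H-bound = H-bounded x
        δ₃ , 0<δ₃ , c₃ , rest-bound = ·ᵥ-locally-bounded {A = λ y → tail
            (A y)} {H} rows′ H-bounded x
        δ₁₂ , 0<δ₁₂ , δ₁₂≤δ₁ , δ₁₂≤δ₂ = smaller 0<δ₁ 0<δ₂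
        δ , 0<δ , δ≤δ₁₂ , δ≤δ₃ = smaller 0<δ₁₂ 0<δ₃
    in δ , 0<δ , c₁ * c₂ + c₃ , λ y d →
         let d₁₂ = ≤-trans d δ≤δ₁₂
             r = row₀-bound y (≤-trans d₁₂ δ₁₂≤δ₁) in
         ≤-trans (split (A y) (H y)) (+-mono-≤
           (≤-trans (*-monoʳ-≤ (norm-nonneg (H y)) r)
                    (*-monoˡ-≤ (≤-trans (norm-nonneg (lookup (A y) zero)) r)
                        (H-bound y (≤-trans d₁₂ δ₁₂≤δ₂))))
           (rest-bound y (≤-trans d δ≤δ₃)))
    where
    lookup-tail : ∀ {n} {S : Set} (v : Vec S (suc n)) i → lookup v (suc i) ≡ lookup (tail v) i
    lookup-tail (_ ∷ _) i = refl

    split : ∀ {M N} (B : Matrix (suc M) N) v →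
      ∣ B ·ᵥ v ∣ ≤ ∣ lookup B zero ∣ * ∣ v ∣ + ∣ tail B ·ᵥ v ∣
    split (r ∷ B) v = ≤-trans (norm-∷ (r ∙ v) (B ·ᵥ v)) (+-mono-≤ (abs-∙ r v) ≤-refl)

    rows′ : ∀ i → LocallyBounded (λ y → lookup (tail (A y)) i)
    rows′ i z = let δ , 0<δ , c , bound = rows (suc i) z in
      δ , 0<δ , c , λ y d → subst (λ v → ∣ v ∣ ≤ c) (lookup-tail (A y) i) (bound y d)

  ball-open : ∀ {N} (p : ℝ^ N) δ → IsOpen (λ x → ∣ x ⊖ p ∣ < δ)
  ball-open p δ x x∈U = δ - ∣ x ⊖ p ∣ , gap< x∈U , λ y d → ≤-<-trans (dist-triangle y x p)
    (certify< (gap< d) (solve 3 (λ δ m n → δ := n :+ m :+ (δ :- m :- n)) refl δ (∣ x ⊖ p ∣)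
        (∣ y ⊖ x ∣)))

  ball-complement-open : ∀ {N} (p : ℝ^ N) r → IsOpen (λ x → r < ∣ x ⊖ p ∣)
  ball-complement-open p r x x∈U = ∣ x ⊖ p ∣ - r , gap< x∈U , λ y d → certify<
    (0<+ (gap< d) (gap (subst (λ k → ∣ x ⊖ p ∣ ≤ k + ∣ y ⊖ p ∣) (dist-comm y x)
        (dist-triangle x y p))))
    (solve 4 (λ r m n k → n := r :+ (m :- r :- k :+ (k :+ n :- m))) refl r (∣ x ⊖ p ∣) (∣ y ⊖ p ∣)
        (∣ y ⊖ x ∣))

  module _ {N} {K : Pred (ℝ^ N) 0ℓ} (K-compact : IsCompact K) where

    -- The cover consists of balls indexed together with a bound of `H` on them, so a finite
    -- subcover brings finitely many bounds, and their maximum works.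
    bounded-on-compact : ∀ {M} {H : ℝ^ N → ℝ^ M} → LocallyBounded H → ∃ λ L → ∀ x → x ∈ K →
      ∣ H x ∣ ≤ L
    bounded-on-compact {H = H} H-bounded =
      let is , covers = K-compact I U U-open cover
          L , bound = maximum is
      in L , λ x x∈K → bound x (covers x x∈K)
      where
      I : Set
      I = ∃ λ p → ∃ λ δ → ∃ λ c → ∀ y → ∣ y ⊖ p ∣ < δ → ∣ H y ∣ ≤ c

      U : I → Pred (ℝ^ N) 0ℓ
      U (p , δ , _) x = ∣ x ⊖ p ∣ < δ

      U-open : ∀ i → IsOpen (U i)
      U-open (p , δ , _) = ball-open p δ

      cover : ∀ x → x ∈ K → ∃ λ i → x ∈ U i
      cover x _ =
        let δ , 0<δ , c , bound = H-bounded x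
        in (x , δ , c , λ y d → bound y (<⇒≤ d)) , subst (_< δ) (sym (dist-self x)) 0<δ

      maximum : (is : List I) → ∃ λ L → ∀ x → Any (λ i → x ∈ U i) is → ∣ H x ∣ ≤ L
      maximum [] = 0# , λ x ()
      maximum ((p , δ , c , bound) ∷ is) = let L , rest = maximum is in
        [ (λ c≤L → L , λ { x (here x∈U) → ≤-trans (bound x x∈U) c≤L ; x (there a) → rest x a })
        , (λ L≤c → c , λ { x (here x∈U) → bound x x∈U ; x (there a) → ≤-trans (rest x a) L≤c })
        ]′ (≤-total c L)

    -- If `p` were outside `K`, the complements of closed balls around `p` would cover `K`. A finite
    -- subcover yields a radius `r` with `K` outside the ball, contrary to adherence.
    compact⇒closed : ∀ p → (∀ ε → 0# < ε → ∃ λ q → q ∈ K × ∣ q ⊖ p ∣ ≤ ε) → p ∈ K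
    compact⇒closed p adherent with em {p ∈ K}
    ... | yes p∈K = p∈K
    ... | no p∉K = ⊥-elim (
      let is , covers = K-compact I U U-open cover
          r , 0<r , far = minimum is
          q , q∈K , near-p = adherent r 0<r
      in <⇒≱ (far q (covers q q∈K)) near-p)
      where
      I : Set
      I = ∃ λ r → 0# < r

      U : I → Pred (ℝ^ N) 0ℓ
      U (r , _) x = r < ∣ x ⊖ p ∣

      U-open : ∀ i → IsOpen (U i)
      U-open (r , _) = ball-complement-open p r

      cover : ∀ x → x ∈ K → ∃ λ i → x ∈ U i
      cover x x∈K =
        let 0<d = ≰⇒> (λ d≤0 → p∉K (subst (_∈ K) (dist-≤0⇒≡ x p d≤0) x∈K))
        in (½ * ∣ x ⊖ p ∣ , 0<½* 0<d) , ½*< 0<d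

      minimum : (is : List I) → ∃ λ r → 0# < r × (∀ x → Any (λ i → x ∈ U i) is → r < ∣ x ⊖ p ∣)
      minimum [] = 1# , 0<1 , λ x ()
      minimum ((r , 0<r) ∷ is) =
        let r′ , 0<r′ , rest = minimum is
            m , 0<m , m≤r , m≤r′ = smaller 0<r 0<r′
        in m , 0<m , λ { x (here x∈U) → ≤-<-trans m≤r x∈U ; x (there a) →
                ≤-<-trans m≤r′ (rest x a) }

  -- The given point of `K` makes the set of norms nonempty; together with the bound this ensures
  -- that `sup` is the supremum and not its default value.
  sup-norm-finite : ∀ {N} {H : ℝ^ N → ℝ^ N} {K : Pred (ℝ^ N) 0ℓ} {x} → x ∈ K →
    (∃ λ L → ∀ x → x ∈ K → ∣ H x ∣ ≤ L) →
    ∃ λ L → ‖ H ‖[ K ] ≡ fin L × 0# ≤ L × (∀ x → x ∈ K → ∣ H x ∣ ≤ L)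
  sup-norm-finite {H = H} {K} {x} x∈K (B , bound) = sup (normsOn H K) , norm≡sup , ≤-trans
      (norm-nonneg (H x)) (le x x∈K) , le
    where
    bounded : Satisfiable (UpperBound (normsOn H K))
    bounded = B , λ { _ (y , y∈K , refl) → bound y y∈K }

    le : ∀ y → y ∈ K → ∣ H y ∣ ≤ sup (normsOn H K)
    le y y∈K = proj₁ (sup-isSupremum (∣ H x ∣ , x , x∈K , refl) bounded) ∣ H y ∣ (y , y∈K , refl)

    norm≡sup : ‖ H ‖[ K ] ≡ fin (sup (normsOn H K))
    norm≡sup with em {Satisfiable (UpperBound (normsOn H K))}
    ... | yes _ = refl
    ... | no ¬b = ⊥-elim (¬b bounded)

  -- Curves obtained by bisection

  -- The intervals `[f n - e n , f n + e n]` are nested, because each step is at most the decrease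
  -- of `e`. The supremum of their left ends lies in all of them.
  cauchy-limit-ℝ : ∀ {f e : ℕ → ℝ} → (∀ n → 0# ≤ e n) →
    (∀ n → abs (f (suc n) - f n) ≤ e n - e (suc n)) →
                   ∃ λ p → ∀ n → abs (p - f n) ≤ e n
  cauchy-limit-ℝ {f} {e} 0≤e step = p , λ n → abs-≤
    (certify (gap (proj₂ (proj₂ S-sup) (f n + e n) λ { _ (m , refl) → lower≤upper m n }))
      (solve 3 (λ p f e → e := p :- f :+ (f :+ e :- p)) refl p (f n) (e n)))
    (certify (gap (proj₁ (proj₂ S-sup) (f n - e n) (n , refl)))
      (solve 3 (λ p f e → e := :- (p :- f) :+ (p :- (f :- e))) refl p (f n) (e n)))
    where
    S : Pred ℝ 0ℓ
    S r = ∃ λ n → r ≡ f n - e n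

    lower-step : ∀ n → f n - e n ≤ f (suc n) - e (suc n)
    lower-step n = certify (gap
        (≤-trans (subst (- (f (suc n) - f n) ≤_) (abs-neg _) (x≤abs _)) (step n)))
      (solve 4 (λ f f′ e e′ → f′ :- e′ := f :- e :+ (e :- e′ :- (:- (f′ :- f)))) refl (f n)
          (f (suc n)) (e n) (e (suc n)))

    upper-step : ∀ n → f (suc n) + e (suc n) ≤ f n + e n
    upper-step n = certify (gap (≤-trans (x≤abs _) (step n)))
      (solve 4 (λ f f′ e e′ → f :+ e := f′ :+ e′ :+ (e :- e′ :- (f′ :- f))) refl (f n) (f (suc n))
          (e n) (e (suc n)))

    lower-mono : ∀ k n → f n - e n ≤ f (k ℕ.+ n) - e (k ℕ.+ n)
    lower-mono zero    n = ≤-refl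
    lower-mono (suc k) n = ≤-trans (lower-mono k n) (lower-step (k ℕ.+ n))

    upper-mono : ∀ k n → f (k ℕ.+ n) + e (k ℕ.+ n) ≤ f n + e n
    upper-mono zero    n = ≤-refl
    upper-mono (suc k) n = ≤-trans (upper-step (k ℕ.+ n)) (upper-mono k n)

    lower≤upper : ∀ m n → f m - e m ≤ f n + e n
    lower≤upper m n = ≤-trans (lower-mono n m) (≤-trans
      (certify (0≤e (n ℕ.+ m) ⊞ 0≤e (n ℕ.+ m))
          (solve 2 (λ f e → f :+ e := f :- e :+ (e :+ e)) refl (f (n ℕ.+ m)) (e (n ℕ.+ m))))
      (subst (λ k → f k + e k ≤ f n + e n) (ℕ.+-comm m n) (upper-mono m n)))

    S-sup : Satisfiable (IsSupremum S)
    S-sup = complete S (f 0 - e 0 , 0 , refl) (f 0 + e 0 , λ { _ (m , refl) → lower≤upper m 0 })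

    p = proj₁ S-sup

  abs-head-⊖ : ∀ {N} (x y : ℝ^ suc N) → abs (head x - head y) ≤ ∣ x ⊖ y ∣
  abs-head-⊖ (x ∷ xs) (y ∷ ys) = abs-head (x - y) (xs ⊖ ys)

  norm-tail-⊖ : ∀ {N} (x y : ℝ^ suc N) → ∣ tail x ⊖ tail y ∣ ≤ ∣ x ⊖ y ∣
  norm-tail-⊖ (x ∷ xs) (y ∷ ys) = norm-tail (x - y) (xs ⊖ ys)

  norm-∷-⊖ : ∀ {N} p (ps : ℝ^ N) x → ∣ (p ∷ ps) ⊖ x ∣ ≤ abs (p - head x) + ∣ ps ⊖ tail x ∣
  norm-∷-⊖ p ps (x ∷ xs) = norm-∷ (p - x) (ps ⊖ xs)

  -- Coordinate by coordinate, adding the errors; the constant `c` is the dimension. It is chosen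
  -- before the sequence, so that one constant serves all segments and parameters of a bisection.
  cauchy-limit : ∀ N → ∃ λ c → 0# ≤ c × (∀ {f : ℕ → ℝ^ N} {e : ℕ → ℝ} → (∀ n → 0# ≤ e n) →
    (∀ n → ∣ f (suc n) ⊖ f n ∣ ≤ e n - e (suc n)) → ∃ λ p → ∀ n → ∣ p ⊖ f n ∣ ≤ c * e n)
  cauchy-limit zero = 0# , ≤-refl , λ {f} 0≤e _ → [] , λ n → ≤-trans
    (≤-reflexive (trans (cong ∣_∣ (unique [] (f n))) (dist-self (f n)))) (≤-refl ⊠ 0≤e n)
    where
    unique : ∀ (x y : ℝ^ 0) → x ⊖ y ≡ y ⊖ y
    unique [] [] = refl
  cauchy-limit (suc N) = let c , 0≤c , limit = cauchy-limit N in
    1# + c , 0≤1 ⊞ 0≤c , λ {f} {e} 0≤e step →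
      let p , p-near = cauchy-limit-ℝ 0≤e λ n → ≤-trans (abs-head-⊖ (f (suc n)) (f n)) (step n)
          ps , ps-near = limit {λ n → tail (f n)} 0≤e λ n → ≤-trans (norm-tail-⊖ (f (suc n)) (f n))
              (step n)
      in p ∷ ps , λ n → ≤-trans (norm-∷-⊖ p ps (f n)) (≤-trans (+-mono-≤ (p-near n) (ps-near n))
           (≤-reflexive (solve 2 (λ c e → e :+ c :* e := (:1 :+ c) :* e) refl c (e n))))

  hal-suc : ∀ n t → hal (suc n) t + hal (suc n) t ≡ hal n t
  hal-suc n t = trans (cong₂ _+_ (hal-* n ½ t) (hal-* n ½ t)) (½x+½x (hal n t))

  -- Decisions about real numbers come from excluded middle and do not compute. Refuting one
  -- alternative still determines the value chosen here.
  branch : ∀ {A P Q : Set} → A → A → P ⊎ Q → A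
  branch v w = [ (λ _ → v) , (λ _ → w) ]′

  branch-inj₁ : ∀ {A P Q : Set} {v w : A} (d : P ⊎ Q) → ¬ Q → branch v w d ≡ v
  branch-inj₁ (inj₁ _) _  = refl
  branch-inj₁ (inj₂ q) ¬q = ⊥-elim (¬q q)

  branch-inj₂ : ∀ {A P Q : Set} {v w : A} (d : P ⊎ Q) → ¬ P → branch v w d ≡ w
  branch-inj₂ (inj₁ p) ¬p = ⊥-elim (¬p p)
  branch-inj₂ (inj₂ _) _  = refl

  branch-preserves : ∀ {A P Q : Set} {v w : A} (X : A → Set) (d : P ⊎ Q) → X v → X w →
    X (branch v w d)
  branch-preserves X (inj₁ _) v∈X _ = v∈X
  branch-preserves X (inj₂ _) _ w∈X = w∈X

  -- What a post-fixpoint offers once the two norms are real numbers `L` and `M` and durations are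
  -- plain reals. The midpoint is data, so that repeated bisection defines vertices as functions of
  -- the level and the parameter.
  record Bisectable {N} (F : ℝ^ N → ℝ^ N) (K : Pred (ℝ^ N) 0ℓ) (L M : ℝ)
      (S : ℝ^ N → ℝ^ N → ℝ → Set) : Set where
    field
      start∈K   : ∀ {x y t} → S x y t → x ∈ K
      first     : ∀ {x y t} → S x y t → ∣ y ⊖ x ∣ ≤ t * L
      second    : ∀ {x y t} → S x y t → dev x y t (F x) ≤ ½ * (t * t) * M
      mid       : ∀ {x y t} → S x y t → ℝ^ N
      leftHalf  : ∀ {x y t} (s : S x y t) → S x (mid s) (½ * t)
      rightHalf : ∀ {x y t} (s : S x y t) → S (mid s) y (½ * t)

  module Bisection {N} {F : ℝ^ N → ℝ^ N} {K : Pred (ℝ^ N) 0ℓ} {L M : ℝ} (0≤L : 0# ≤ L)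
    {S : ℝ^ N → ℝ^ N → ℝ → Set} (bisectable : Bisectable F K L M S)
    (K-closed : ∀ p → (∀ ε → 0# < ε → ∃ λ q → q ∈ K × ∣ q ⊖ p ∣ ≤ ε) → p ∈ K) where

    open Bisectable bisectable

    -- The duration is positive so that the parameter 0 lies in the left half at each level;
    -- `vertex-0` and `curve-0` rest on this.
    record Segment : Set where
      constructor segment
      field
        {x y} : ℝ^ N
        {t}   : ℝ
        0<t   : 0# < t
        inS   : S x y t

      ½t : ℝ
      ½t = ½ * t

    open Segment

    left right : Segment → Segment
    left  σ = segment (0<½* (0<t σ)) (leftHalf (inS σ))
    right σ = segment (0<½* (0<t σ)) (rightHalf (inS σ))

    0≤½t : ∀ σ → 0# ≤ ½t σ
    0≤½t σ = <⇒≤ (0<½* (0<t σ))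

    -- The left endpoint of the n-th level segment over the parameter s.
    vertex : ℕ → Segment → ℝ → ℝ^ N
    vertex zero    σ s = x σ
    vertex (suc n) σ s = branch (vertex n (right σ) (s - ½t σ)) (vertex n (left σ) s)
        (≤-total-strict (½t σ) s)

    vertex-right : ∀ n σ {s} → ½t σ ≤ s → vertex (suc n) σ s ≡ vertex n (right σ) (s - ½t σ)
    vertex-right n σ {s} ½t≤s = branch-inj₁ (≤-total-strict (½t σ) s) λ s<½t → <⇒≱ s<½t ½t≤s

    vertex-left : ∀ n σ {s} → s < ½t σ → vertex (suc n) σ s ≡ vertex n (left σ) s
    vertex-left n σ {s} s<½t = branch-inj₂ (≤-total-strict (½t σ) s) (<⇒≱ s<½t)

    vertex∈K : ∀ n σ s → vertex n σ s ∈ K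
    vertex∈K zero    σ s = start∈K (inS σ)
    vertex∈K (suc n) σ s = branch-preserves K (≤-total-strict (½t σ) s)
        (vertex∈K n (right σ) (s - ½t σ)) (vertex∈K n (left σ) s)

    vertex-0 : ∀ n σ → vertex n σ 0# ≡ x σ
    vertex-0 zero    σ = refl
    vertex-0 (suc n) σ = trans (vertex-left n σ (0<½* (0<t σ))) (vertex-0 n (left σ))

    t-½t : ∀ σ → t σ - ½t σ ≡ ½t σ
    t-½t σ = ≡-via (sym (½x+½x (t σ)))
        (solve 2 (λ t h → t :- h :+ (h :+ h) := h :+ t) refl (t σ) (½t σ))

    -- The parameter `t σ` falls in the right half at each level, so its vertex is the start of the
    -- last segment, and that segment ends at `y σ`.
    vertex-end : ∀ n σ → ∣ y σ ⊖ vertex n σ (t σ) ∣ ≤ L * hal n (t σ)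
    vertex-end zero    σ = subst (∣ y σ ⊖ x σ ∣ ≤_) (R.*-comm (t σ) L) (first (inS σ))
    vertex-end (suc n) σ = subst (λ v → ∣ y σ ⊖ v ∣ ≤ L * hal n (½t σ))
      (sym (trans (vertex-right n σ (½*≤ (<⇒≤ (0<t σ)))) (cong (vertex n (right σ)) (t-½t σ))))
      (vertex-end n (right σ))

    -- One more level either keeps the vertex or moves it to the midpoint of its segment; `first`
    -- for the left half limits this move.
    vertex-step : ∀ n σ s → ∣ vertex (suc n) σ s ⊖ vertex n σ s ∣ ≤ hal (suc n) (t σ) * L
    vertex-step zero σ s = [ (λ ½t≤s → at (mid (inS σ)) (vertex-right zero σ ½t≤s)
        (first (leftHalf (inS σ))))
                           , (λ s<½t → at (x σ) (vertex-left zero σ s<½t)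
                               (subst (_≤ ½t σ * L) (sym (dist-self (x σ))) (0≤½t σ ⊠ 0≤L)))
                           ]′ (≤-total-strict (½t σ) s)
      where
      at : ∀ v → vertex 1 σ s ≡ v → ∣ v ⊖ x σ ∣ ≤ ½t σ * L → ∣ vertex 1 σ s ⊖ x σ ∣ ≤ ½t σ * L
      at v eq = subst (λ w → ∣ w ⊖ x σ ∣ ≤ ½t σ * L) (sym eq)
    vertex-step (suc n) σ s = [
        (λ ½t≤s → at (vertex-right (suc n) σ ½t≤s) (vertex-right n σ ½t≤s)
        (vertex-step n (right σ) (s - ½t σ)))
                              , (λ s<½t → at (vertex-left (suc n) σ s<½t) (vertex-left n σ s<½t)
                                  (vertex-step n (left σ) s))
                              ]′ (≤-total-strict (½t σ) s)
      where
      at : ∀ {v w} → vertex (suc (suc n)) σ s ≡ v → vertex (suc n) σ s ≡ w →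
           ∣ v ⊖ w ∣ ≤ hal (suc n) (½t σ) * L →
               ∣ vertex (suc (suc n)) σ s ⊖ vertex (suc n) σ s ∣ ≤ hal (suc n) (½t σ) * L
      at eq eq′ = subst₂ (λ v w → ∣ v ⊖ w ∣ ≤ hal (suc n) (½t σ) * L) (sym eq) (sym eq′)

    private
      c = proj₁ (cauchy-limit N)
      0≤c = proj₁ (proj₂ (cauchy-limit N))

      cL = c * L
      0≤cL = 0≤c ⊠ 0≤L

    abstract
      -- The move from level `n` to the next is at most half of `hal n (t σ) * L`, which is exactly
      -- the decrease of this error, as `cauchy-limit` requires. Everything later uses the limit
      -- only through `curve-near`.
      vertex-limit : ∀ σ s → ∃ λ p → ∀ n → ∣ p ⊖ vertex n σ s ∣ ≤ c * (hal n (t σ) * L)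
      vertex-limit σ s = proj₂ (proj₂ (cauchy-limit N)) {λ n → vertex n σ s} {λ n → hal n (t σ) * L}
        (λ n → hal-nonneg n (<⇒≤ (0<t σ)) ⊠ 0≤L)
        (λ n → subst (∣ vertex (suc n) σ s ⊖ vertex n σ s ∣ ≤_)
          (≡-via (cong (_* L) (hal-suc n (t σ)))
            (solve 3 (λ h k L → h :* L :+ k :* L := k :* L :- h :* L :+ (h :+ h) :* L) refl
                (hal (suc n) (t σ)) (hal n (t σ)) L))
          (vertex-step n σ s))

      curve : Segment → ℝ → ℝ^ N
      curve σ s = proj₁ (vertex-limit σ s)

      curve-near : ∀ n σ s → ∣ curve σ s ⊖ vertex n σ s ∣ ≤ cL * hal n (t σ)
      curve-near n σ s = subst (∣ curve σ s ⊖ vertex n σ s ∣ ≤_)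
        (solve 3 (λ c h L → c :* (h :* L) := c :* L :* h) refl c (hal n (t σ)) L)
            (proj₂ (vertex-limit σ s) n)

    -- Two points that approximate the same vertices at a rate proportional to `hal n (t σ)`
    -- coincide. Identities of curves are thereby reduced to identities of vertices.
    curve-unique : ∀ σ s p C → (∀ n → ∣ p ⊖ vertex n σ s ∣ ≤ C * hal n (t σ)) → p ≡ curve σ s
    curve-unique σ s p C near = dist-≤0⇒≡ p (curve σ s) (≤-hal-limit (C + cL) (t σ) λ n →
      ≤-trans (dist-triangle p (vertex n σ s) (curve σ s)) (≤-trans
        (+-mono-≤ (near n) (subst (_≤ cL * hal n (t σ)) (dist-comm (vertex n σ s) (curve σ s))
            (curve-near n σ s)))
        (≤-reflexive (solve 3 (λ C d h → C :* h :+ d :* h := :0 :+ (C :+ d) :* h) refl C cL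
            (hal n (t σ))))))

    curve∈K : ∀ σ s → curve σ s ∈ K
    curve∈K σ s = K-closed (curve σ s) λ ε 0<ε →
      let n , small = hal-small cL (t σ) 0<ε in
      vertex n σ s , vertex∈K n σ s , subst (_≤ ε) (dist-comm (vertex n σ s) (curve σ s))
          (≤-trans (curve-near n σ s) small)

    curve-0 : ∀ σ → curve σ 0# ≡ x σ
    curve-0 σ = sym (curve-unique σ 0# (x σ) 0# λ n → ≤-reflexive
      (trans (cong (λ v → ∣ x σ ⊖ v ∣) (vertex-0 n σ))
          (trans (dist-self (x σ)) (sym (R.zeroˡ (hal n (t σ)))))))

    curve-end : ∀ σ → curve σ (t σ) ≡ y σ
    curve-end σ = sym (curve-unique σ (t σ) (y σ) L λ n → vertex-end n σ)

    curve-right : ∀ σ {s} → ½t σ ≤ s → curve σ s ≡ curve (right σ) (s - ½t σ)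
    curve-right σ {s} ½t≤s = curve-unique (right σ) (s - ½t σ) (curve σ s) cL λ n →
      subst (λ v → ∣ curve σ s ⊖ v ∣ ≤ cL * hal n (½t σ)) (vertex-right n σ ½t≤s)
          (curve-near (suc n) σ s)

    -- At the parameter `½t σ` the vertices are those of the right half, so agreement with the left
    -- half is not immediate: both halves take the value `mid` there, one at its start and the other
    -- at its end.
    curve-junction : ∀ σ → curve σ (½t σ) ≡ curve (left σ) (½t σ)
    curve-junction σ = begin
      curve σ (½t σ)                   ≡⟨ curve-right σ ≤-refl ⟩
      curve (right σ) (½t σ - ½t σ)    ≡⟨ cong (curve (right σ)) (R.-‿inverseʳ (½t σ)) ⟩
      curve (right σ) 0#               ≡⟨ curve-0 (right σ) ⟩
      mid (inS σ)                      ≡⟨ curve-end (left σ) ⟨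
      curve (left σ) (½t σ)            ∎

    curve-left : ∀ σ {s} → s ≤ ½t σ → curve σ s ≡ curve (left σ) s
    curve-left σ {s} s≤½t = [ at-mid , before ]′ (≤-total-strict (½t σ) s)
      where
      at-mid : ½t σ ≤ s → curve σ s ≡ curve (left σ) s
      at-mid ½t≤s = subst (λ r → curve σ r ≡ curve (left σ) r) (≤-antisym ½t≤s s≤½t)
          (curve-junction σ)

      before : s < ½t σ → curve σ s ≡ curve (left σ) s
      before s<½t = curve-unique (left σ) s (curve σ s) cL λ n →
        subst (λ v → ∣ curve σ s ⊖ v ∣ ≤ cL * hal n (½t σ)) (vertex-left n σ s<½t)
            (curve-near (suc n) σ s)

    -- The mean value inequality for the limit curve

    module _ (v : ℝ^ N) (ε : ℝ) where

      private
        Near : Segment → ℝ → ℝ → Set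
        Near σ s s′ = ∀ r → s ≤ r → r ≤ s′ → ∣ F (curve σ r) ⊖ v ∣ ≤ ε

        -- The summand `δ` is the error still tolerated: it adds up under `dev≤-trans` and is driven
        -- to 0 by `dev≤-limit`.
        Dev≤ : Segment → ℝ → ℝ → ℝ → Set
        Dev≤ σ s s′ δ = dev (curve σ s) (curve σ s′) (s′ - s) v ≤ (s′ - s) * ε + δ

        near⇒0≤ε : ∀ σ {s s′} → s ≤ s′ → Near σ s s′ → 0# ≤ ε
        near⇒0≤ε σ {s} s≤s′ near = ≤-trans (norm-nonneg (F (curve σ s) ⊖ v)) (near s ≤-refl s≤s′)

        near-left : ∀ σ {s s′} → s′ ≤ ½t σ → Near σ s s′ → Near (left σ) s s′
        near-left σ s′≤½t near r s≤r r≤s′ =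
          subst (λ p → ∣ F p ⊖ v ∣ ≤ ε) (curve-left σ (≤-trans r≤s′ s′≤½t)) (near r s≤r r≤s′)

        shift : ∀ σ r → ½t σ + r - ½t σ ≡ r
        shift σ r = solve 2 (λ h r → h :+ r :- h := r) refl (½t σ) r

        curve-shift : ∀ σ {r} → 0# ≤ r → curve σ (½t σ + r) ≡ curve (right σ) r
        curve-shift σ {r} 0≤r = trans (curve-right σ (certify 0≤r refl))
            (cong (curve (right σ)) (shift σ r))

        near-right : ∀ σ {r r′} → 0# ≤ r → Near σ (½t σ + r) (½t σ + r′) → Near (right σ) r r′
        near-right σ 0≤r near q r≤q q≤r′ = subst (λ p → ∣ F p ⊖ v ∣ ≤ ε)
            (curve-shift σ (≤-trans 0≤r r≤q))
          (near (½t σ + q) (+-mono-≤ ≤-refl r≤q) (+-mono-≤ ≤-refl q≤r′))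

        dev≤-left : ∀ σ {s s′ δ} → s ≤ ½t σ → s′ ≤ ½t σ → Dev≤ (left σ) s s′ δ → Dev≤ σ s s′ δ
        dev≤-left σ {s} {s′} {δ} s≤½t s′≤½t = subst₂ (λ p q → dev p q (s′ - s) v ≤ (s′ - s) * ε + δ)
          (sym (curve-left σ s≤½t)) (sym (curve-left σ s′≤½t))

        dev≤-right : ∀ σ {r r′ δ} → 0# ≤ r → 0# ≤ r′ → Dev≤ (right σ) r r′ δ →
          Dev≤ σ (½t σ + r) (½t σ + r′) δ
        dev≤-right σ {r} {r′} {δ} 0≤r 0≤r′ d = subst
            (λ l → dev (curve σ (½t σ + r)) (curve σ (½t σ + r′)) l v ≤ l * ε + δ)
          (solve 3 (λ h r r′ → r′ :- r := h :+ r′ :- (h :+ r)) refl (½t σ) r r′)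
          (subst₂ (λ p q → dev p q (r′ - r) v ≤ (r′ - r) * ε + δ) (sym (curve-shift σ 0≤r))
              (sym (curve-shift σ 0≤r′)) d)

        dev≤-trans : ∀ σ {p q r δ δ′} → Dev≤ σ p q δ → Dev≤ σ q r δ′ → Dev≤ σ p r (δ + δ′)
        dev≤-trans σ {p} {q} {r} {δ} {δ′} d d′ = ≤-trans (dev-glue (curve σ) v p q r)
            (≤-trans (+-mono-≤ d d′)
          (≤-reflexive (solve 6
              (λ p q r ε δ δ′ → (q :- p) :* ε :+ δ :+ ((r :- q) :* ε :+ δ′) := (r :- p) :* ε :+
              (δ :+ δ′))
            refl p q r ε δ δ′)))

        dev≤-limit : ∀ σ {s s′} C → (∀ n → Dev≤ σ s s′ (C * hal n (t σ))) → Dev≤ σ s s′ 0#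
        dev≤-limit σ {s} {s′} C d = ≤-trans (≤-hal-limit C (t σ) d) (certify ≤-refl refl)

        near-restrict : ∀ σ {s s′ r r′} → s ≤ r → r′ ≤ s′ → Near σ s s′ → Near σ r r′
        near-restrict σ s≤r r′≤s′ near q r≤q q≤r′ = near q (≤-trans s≤r r≤q) (≤-trans q≤r′ r′≤s′)

        ½t≤t : ∀ σ → ½t σ ≤ t σ
        ½t≤t σ = ½*≤ (<⇒≤ (0<t σ))

        at-end : ∀ σ → ½t σ + ½t σ ≡ t σ
        at-end σ = ½x+½x (t σ)

        at-mid : ∀ σ → ½t σ + 0# ≡ ½t σ
        at-mid σ = R.+-identityʳ (½t σ)

        -- Each segment of level `n` contributes `½ M` times the square of its length `hal n (t σ)`,
        -- by the second bound of `G` with the velocity at its start. The lengths add up to `t σ`,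
        -- which leaves one factor `hal n (t σ)`.
        whole-approx : ∀ n σ → Near σ 0# (t σ) → Dev≤ σ 0# (t σ) (½ * M * t σ * hal n (t σ))
        whole-approx zero σ near = subst₂
            (λ p q → dev p q (t σ - 0#) v ≤ (t σ - 0#) * ε + ½ * M * t σ * t σ)
          (sym (curve-0 σ)) (sym (curve-end σ))
          (subst (λ l → dev (x σ) (y σ) l v ≤ l * ε + ½ * M * t σ * t σ)
              (solve 1 (λ t → t := t :- :0) refl (t σ))
            (≤-trans (dev-change (x σ) (y σ) (<⇒≤ (0<t σ)) v (F (x σ)))
              (≤-trans (+-mono-≤ (second (inS σ)) (*-monoˡ-≤ (<⇒≤ (0<t σ))
                  (subst (λ p → ∣ F p ⊖ v ∣ ≤ ε) (curve-0 σ) (near 0# ≤-refl (<⇒≤ (0<t σ))))))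
                (≤-reflexive (solve 4 (λ h t M ε → h :* (t :* t) :* M :+ t :* ε :=
                    t :* ε :+ h :* M :* t :* t) refl ½ (t σ) M ε)))))
        whole-approx (suc n) σ near = subst₂ (Dev≤ σ 0#) (at-end σ)
          (trans (solve 4 (λ h M k z → h :* M :* k :* z :+ h :* M :* k :* z :=
              h :* M :* (k :+ k) :* z) refl ½ M (½t σ) (hal n (½t σ)))
            (cong (λ l → ½ * M * l * hal n (½t σ)) (at-end σ)))
          (dev≤-trans σ
            (dev≤-left σ (0≤½t σ) ≤-refl
                (whole-approx n (left σ)
                (near-left σ ≤-refl (near-restrict σ ≤-refl (½t≤t σ) near))))
            (subst (λ s → Dev≤ σ s (½t σ + ½t σ) (½ * M * ½t σ * hal n (½t σ))) (at-mid σ)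
              (dev≤-right σ ≤-refl (0≤½t σ) (whole-approx n (right σ) (near-right σ ≤-refl
                (near-restrict σ (≤-trans (0≤½t σ) (certify ≤-refl refl))
                    (≤-reflexive (at-end σ)) near))))))

        whole : ∀ σ → Near σ 0# (t σ) → Dev≤ σ 0# (t σ) 0#
        whole σ near = dev≤-limit σ (½ * M * t σ) λ n → whole-approx n σ near

        C = cL + cL + ∣ v ∣

        -- Both curve points lie within `cL * t σ` of `x σ`, and `(s′ - s) ∣ v ∣` is at most
        -- `t σ * ∣ v ∣`; hence the three summands of `C`. The bound is only of first order in the
        -- duration, which is enough for a single segment of level `n`.
        coarse : ∀ σ {s s′} → 0# ≤ s → s ≤ s′ → s′ ≤ t σ → Near σ s s′ → Dev≤ σ s s′ (C * t σ)
        coarse σ {s} {s′} 0≤s s≤s′ s′≤t near = ≤-trans (dev-≤ (curve σ s) (curve σ s′) (gap s≤s′) v)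
          (certify (gap (dist-triangle (curve σ s′) (x σ) (curve σ s)) ⊞ gap (curve-near 0 σ s′)
              ⊞ gap (subst (_≤ cL * t σ) (dist-comm (x σ) (curve σ s)) (curve-near 0 σ s))
              ⊞ (gap s′≤t ⊞ 0≤s) ⊠ norm-nonneg v ⊞ gap s≤s′ ⊠ near⇒0≤ε σ s≤s′ near)
            (solve 9 (λ n a b c t s s′ v ε → (s′ :- s) :* ε :+ (c :+ c :+ v) :* t :=
                n :+ (s′ :- s) :* v :+
                    (a :+ b :- n :+ (c :* t :- a) :+ (c :* t :- b) :+ (t :- s′ :+ s) :* v :+
                    (s′ :- s) :* ε))
              refl (∣ curve σ s′ ⊖ curve σ s ∣) (∣ curve σ s′ ⊖ x σ ∣) (∣ x σ ⊖ curve σ s ∣) cL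
                  (t σ) s s′ (∣ v ∣) ε))

        ½t+[s-½t] : ∀ σ s → ½t σ + (s - ½t σ) ≡ s
        ½t+[s-½t] σ s = solve 2 (λ h s → h :+ (s :- h) := s) refl (½t σ) s

        s-½t≤½t : ∀ σ {s} → s ≤ t σ → s - ½t σ ≤ ½t σ
        s-½t≤½t σ {s} s≤t = certify (gap s≤t)
            (≡-via (at-end σ) (solve 3 (λ h s t →
            h :+ t := s :- h :+ (t :- s) :+ (h :+ h)) refl (½t σ) s (t σ)))

        -- If `s` lies in the right half, the left half is handled without error by `whole`;
        -- otherwise only the left half matters. The rough bound is thus paid once, on the segment
        -- of level `n` that contains `s`.
        prefix-approx : ∀ n σ {s} → 0# ≤ s → s ≤ t σ → Near σ 0# s → Dev≤ σ 0# s (C * hal n (t σ))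
        prefix-approx zero    σ 0≤s s≤t near = coarse σ ≤-refl 0≤s s≤t near
        prefix-approx (suc n) σ {s} 0≤s s≤t near =
          [ (λ ½t≤s → subst₂ (Dev≤ σ 0#) (½t+[s-½t] σ s) (R.+-identityˡ (C * hal n (½t σ)))
              (dev≤-trans σ
              (dev≤-left σ (0≤½t σ) ≤-refl
                  (whole (left σ) (near-left σ ≤-refl (near-restrict σ ≤-refl ½t≤s near))))
              (subst (λ q → Dev≤ σ q (½t σ + (s - ½t σ)) (C * hal n (½t σ))) (at-mid σ)
                (dev≤-right σ ≤-refl (gap ½t≤s)
                    (prefix-approx n (right σ) (gap ½t≤s) (s-½t≤½t σ s≤t)
                  (near-right σ ≤-refl
                      (near-restrict σ (≤-trans (0≤½t σ) (certify ≤-refl refl))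
                      (≤-reflexive (½t+[s-½t] σ s)) near)))))))
          , (λ s<½t → dev≤-left σ (0≤½t σ) (<⇒≤ s<½t)
              (prefix-approx n (left σ) 0≤s (<⇒≤ s<½t) (near-left σ (<⇒≤ s<½t) near)))
          ]′ (≤-total-strict (½t σ) s)

        prefix : ∀ σ {s} → 0# ≤ s → s ≤ t σ → Near σ 0# s → Dev≤ σ 0# s 0#
        prefix σ 0≤s s≤t near = dev≤-limit σ C λ n → prefix-approx n σ 0≤s s≤t near

        suffix-approx : ∀ n σ {s} → 0# ≤ s → s ≤ t σ → Near σ s (t σ) →
          Dev≤ σ s (t σ) (C * hal n (t σ))
        suffix-approx zero    σ 0≤s s≤t near = coarse σ 0≤s s≤t ≤-refl near
        suffix-approx (suc n) σ {s} 0≤s s≤t near =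
          [ (λ ½t≤s → subst₂ (λ p q → Dev≤ σ p q (C * hal n (½t σ))) (½t+[s-½t] σ s) (at-end σ)
              (dev≤-right σ (gap ½t≤s) (0≤½t σ)
                  (suffix-approx n (right σ) (gap ½t≤s) (s-½t≤½t σ s≤t)
                (near-right σ (gap ½t≤s)
                    (near-restrict σ (≤-reflexive (sym (½t+[s-½t] σ s)))
                    (≤-reflexive (at-end σ)) near)))))
          , (λ s<½t → subst₂ (Dev≤ σ s) (at-end σ) (R.+-identityʳ (C * hal n (½t σ))) (dev≤-trans σ
              (dev≤-left σ (<⇒≤ s<½t) ≤-refl
                  (suffix-approx n (left σ) 0≤s (<⇒≤ s<½t)
                  (near-left σ ≤-refl (near-restrict σ ≤-refl (½t≤t σ) near))))
              (subst (λ q → Dev≤ σ q (½t σ + ½t σ) 0#) (at-mid σ)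
                (dev≤-right σ ≤-refl (0≤½t σ) (whole (right σ)
                  (near-right σ ≤-refl
                      (near-restrict σ (≤-trans (<⇒≤ s<½t) (certify ≤-refl refl))
                      (≤-reflexive (at-end σ)) near)))))))
          ]′ (≤-total-strict (½t σ) s)

        suffix : ∀ σ {s} → 0# ≤ s → s ≤ t σ → Near σ s (t σ) → Dev≤ σ s (t σ) 0#
        suffix σ 0≤s s≤t near = dev≤-limit σ C λ n → suffix-approx n σ 0≤s s≤t near

        -- Descend while both ends lie in the same half. Once the midpoint separates them, `suffix`
        -- on the left and `prefix` on the right have error 0. Ends not separated within `n` levels
        -- share a segment of length `hal n (t σ)`, where `coarse` applies.
        interval-approx : ∀ n σ {s s′} → 0# ≤ s → s ≤ s′ → s′ ≤ t σ → Near σ s s′ →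
          Dev≤ σ s s′ (C * hal n (t σ))
        interval-approx zero    σ 0≤s s≤s′ s′≤t near = coarse σ 0≤s s≤s′ s′≤t near
        interval-approx (suc n) σ {s} {s′} 0≤s s≤s′ s′≤t near =
          [ (λ ½t≤s → let ½t≤s′ = ≤-trans ½t≤s s≤s′ in
              subst₂ (λ p q → Dev≤ σ p q (C * hal n (½t σ))) (½t+[s-½t] σ s) (½t+[s-½t] σ s′)
                (dev≤-right σ (gap ½t≤s) (gap ½t≤s′)
                    (interval-approx n (right σ) (gap ½t≤s) (+-monoˡ-≤ (- ½t σ) s≤s′)
                    (s-½t≤½t σ s′≤t)
                  (near-right σ (gap ½t≤s)
                      (near-restrict σ (≤-reflexive (sym (½t+[s-½t] σ s)))
                      (≤-reflexive (½t+[s-½t] σ s′)) near)))))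
          , (λ s<½t →
            [ (λ ½t≤s′ → ≤-trans
                (subst₂ (Dev≤ σ s) (½t+[s-½t] σ s′) (R.+-identityʳ 0#) (dev≤-trans σ
                  (dev≤-left σ (<⇒≤ s<½t) ≤-refl
                      (suffix (left σ) 0≤s (<⇒≤ s<½t)
                      (near-left σ ≤-refl (near-restrict σ ≤-refl ½t≤s′ near))))
                  (subst (λ q → Dev≤ σ q (½t σ + (s′ - ½t σ)) 0#) (at-mid σ)
                    (dev≤-right σ ≤-refl (gap ½t≤s′) (prefix (right σ) (gap ½t≤s′) (s-½t≤½t σ s′≤t)
                      (near-right σ ≤-refl
                          (near-restrict σ (≤-trans (<⇒≤ s<½t) (certify ≤-refl refl))
                          (≤-reflexive (½t+[s-½t] σ s′)) near)))))))
                (+-mono-≤ ≤-refl ((0≤cL ⊞ 0≤cL ⊞ norm-nonneg v) ⊠ hal-nonneg n (0≤½t σ))))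
            , (λ s′<½t → dev≤-left σ (<⇒≤ s<½t) (<⇒≤ s′<½t)
                (interval-approx n (left σ) 0≤s s≤s′ (<⇒≤ s′<½t) (near-left σ (<⇒≤ s′<½t) near)))
            ]′ (≤-total-strict (½t σ) s′))
          ]′ (≤-total-strict (½t σ) s)

      curve-mean-value-at : ∀ σ {s s′} → 0# ≤ s → s ≤ s′ → s′ ≤ t σ → Near σ s s′ →
                            dev (curve σ s) (curve σ s′) (s′ - s) v ≤ (s′ - s) * ε
      curve-mean-value-at σ 0≤s s≤s′ s′≤t near = ≤-hal-limit C
          (t σ) λ n → interval-approx n σ 0≤s s≤s′ s′≤t near

    curve-mean-value : ∀ σ → MeanValue F (curve σ) 0# (t σ)
    curve-mean-value σ v ε = curve-mean-value-at v ε σ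

  -- The fixpoint

  module _ {N} (F : ℝ^ N → ℝ^ N) where

    mean-value-cong : ∀ {γ γ′ a b} → (∀ r → a ≤ r → r ≤ b → γ r ≡ γ′ r) → MeanValue F γ a b →
      MeanValue F γ′ a b
    mean-value-cong {γ} {γ′} eq mean v ε {s} {s′} a≤s s≤s′ s′≤b near =
      subst₂ (λ p q → dev p q (s′ - s) v ≤ (s′ - s) * ε) (eq s a≤s (≤-trans s≤s′ s′≤b))
          (eq s′ (≤-trans a≤s s≤s′) s′≤b)
        (mean v ε a≤s s≤s′ s′≤b λ r s≤r r≤s′ →
          subst (λ p → ∣ F p ⊖ v ∣ ≤ ε) (sym (eq r (≤-trans a≤s s≤r) (≤-trans r≤s′ s′≤b)))
              (near r s≤r r≤s′))

    mean-value-shift : ∀ {γ a b} d → MeanValue F γ (a + d) (b + d) →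
      MeanValue F (λ s → γ (s + d)) a b
    mean-value-shift {γ} d mean v ε {s} {s′} a≤s s≤s′ s′≤b near =
      subst (λ l → dev (γ (s + d)) (γ (s′ + d)) l v ≤ l * ε)
          (solve 3 (λ s s′ d → s′ :+ d :- (s :+ d) := s′ :- s) refl s s′ d)
        (mean v ε (+-monoˡ-≤ d a≤s) (+-monoˡ-≤ d s≤s′) (+-monoˡ-≤ d s′≤b) λ r s+d≤r r≤s′+d →
          subst (λ q → ∣ F (γ q) ⊖ v ∣ ≤ ε) (solve 2 (λ r d → r :- d :+ d := r) refl r d)
            (near (r - d) (certify (gap s+d≤r)
                (solve 3 (λ s d r → r :- d := s :+ (r :- (s :+ d))) refl s d r))
                          (certify (gap r≤s′+d)
                              (solve 3 (λ s d r → s := r :- d :+ (s :+ d :- r)) refl s′ d r))))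

    mean-value-restrict : ∀ {γ a a′ b b′} → a ≤ a′ → b′ ≤ b → MeanValue F γ a b →
      MeanValue F γ a′ b′
    mean-value-restrict a≤a′ b′≤b mean v ε a′≤s s≤s′ s′≤b′ = mean v ε (≤-trans a≤a′ a′≤s) s≤s′
        (≤-trans s′≤b′ b′≤b)

    mean-value-join : ∀ {γ a m b} → MeanValue F γ a m → MeanValue F γ m b → MeanValue F γ a b
    mean-value-join {γ} {a} {m} {b} mean₁ mean₂ v ε {s} {s′} a≤s s≤s′ s′≤b near =
      [ (λ m≤s → mean₂ v ε m≤s s≤s′ s′≤b near)
      , (λ s≤m →
        [ (λ m≤s′ → ≤-trans (dev-glue γ v s m s′) (≤-trans (+-mono-≤
            (mean₁ v ε a≤s s≤m ≤-refl λ r s≤r r≤m → near r s≤r (≤-trans r≤m m≤s′))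
            (mean₂ v ε ≤-refl m≤s′ s′≤b λ r m≤r r≤s′ → near r (≤-trans s≤m m≤r) r≤s′))
                (≤-reflexive (+-*-glue s m s′ ε))))
        , (λ s′≤m → mean₁ v ε a≤s s≤s′ s′≤m near)
        ]′ (≤-total m s′))
      ]′ (≤-total m s)

    mean-value-degenerate : ∀ {γ a b} → b ≤ a → MeanValue F γ a b
    mean-value-degenerate {γ} {a} {b} b≤a v ε {s} {s′} a≤s s≤s′ s′≤b near = subst
        (λ r → dev (γ s) (γ r) (r - s) v ≤ (r - s) * ε) s≡s′
      (subst (λ l → dev (γ s) (γ s) (s - s) v ≤ l)
          (sym (trans (cong (_* ε) (R.-‿inverseʳ s)) (R.zeroˡ ε)))
          (dev-self (γ s) (R.-‿inverseʳ s) v))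
      where
      s≡s′ = ≤-antisym s≤s′ (≤-trans s′≤b (≤-trans b≤a a≤s))

  -- The proof stored in `t` is irrelevant; excluded middle decides the inequality and so restores a
  -- usable one.
  value-nonneg : (t : ℝ≥0) → 0# ≤ value t
  value-nonneg (_ Refinement., [ 0≤t ]) = recompute em 0≤t

  module _ {N} {F : ℝ^ N → ℝ^ N} (C¹ : ContinuouslyDifferentiable F) {K : Pred (ℝ^ N) 0ℓ} where

    open ContinuouslyDifferentiable C¹

    Γ-monotone : Monotone (Γ C¹ K)
    Γ-monotone Z⊆Z′ {_ , _ , _}
        (z∈G , x∈K , y∈K , u , xu∈Z , uy∈Z) = z∈G , x∈K , y∈K , u , Z⊆Z′ xu∈Z , Z⊆Z′ uy∈Z

    module _ (K-compact : IsCompact K) where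

      F-continuous : ∀ x → ContinuousAt F x
      F-continuous x = jacobian⇒continuous {f = F} {x} {D x} (hasJacobian x)

      DF·F : ℝ^ N → ℝ^ N
      DF·F z = D z ·ᵥ F z

      ‖F‖-finite : ∀ {x} → x ∈ K → ∃ λ L → ‖ F ‖[ K ] ≡ fin L × 0# ≤ L × (∀ z → z ∈ K → ∣ F z ∣ ≤ L)
      ‖F‖-finite x∈K = sup-norm-finite {H = F} x∈K
          (bounded-on-compact K-compact {H = F} (continuous⇒locally-bounded {H = F} F-continuous))

      ‖DF·F‖-finite : ∀ {x} → x ∈ K →
        ∃ λ M → ‖ DF·F ‖[ K ] ≡ fin M × 0# ≤ M × (∀ z → z ∈ K → ∣ DF·F z ∣ ≤ M)
      ‖DF·F‖-finite x∈K = sup-norm-finite {H = DF·F} x∈K (bounded-on-compact K-compact {H = DF·F}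
        (·ᵥ-locally-bounded {A = D} {F}
          (λ i → continuous⇒locally-bounded {H = λ x → lookup (D x) i}
              (Continuous⇒ContinuousAt {H = λ x → lookup (D x) i} (D-continuous i)))
          (continuous⇒locally-bounded {H = F} F-continuous)))

      mean-value⇒ℛ : ∀ γ (t : ℝ≥0) → MeanValue F γ 0# (value t) →
        (∀ s → 0# ≤ s → s ≤ value t → γ s ∈ K) →
                     (γ 0# , γ (value t) , t) ∈ ℛ[ F , K ]
      mean-value⇒ℛ γ t mean γ∈K =
        let L , _ , 0≤L , F≤L = ‖F‖-finite (γ∈K 0# ≤-refl (value-nonneg t)) in
        γ , mean-value⇒integral-curve F γ mean
            (λ r 0≤r r≤t → F≤L (γ r) (γ∈K r 0≤r r≤t)) 0≤L F-continuous ,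
        refl , refl , γ∈K

      ℛ⊆Γℛ : ℛ[ F , K ] ⊆ Γ C¹ K ℛ[ F , K ]
      ℛ⊆Γℛ {x , y , t} (γ , integral , refl , refl , γ∈K) =
        let L , ‖F‖≡L , 0≤L , F≤L = ‖F‖-finite (γ∈K 0# ≤-refl 0≤t)
            M , ‖DFF‖≡M , 0≤M , DFF≤M = ‖DF·F‖-finite (γ∈K 0# ≤-refl 0≤t)
            speed : ∀ r → 0# ≤ r → r ≤ τ → ∣ F (γ r) ∣ ≤ L
            speed r 0≤r r≤t = F≤L (γ r) (γ∈K r 0≤r r≤t)
            accel : ∀ {s s′} → 0# ≤ s → s ≤ s′ → s′ ≤ τ → ∣ F (γ s′) ⊖ F (γ s) ∣ ≤ (s′ - s) * M
            accel = acceleration F γ mean speed 0≤L {D} hasJacobian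
                (λ r 0≤r r≤t → DFF≤M (γ r) (γ∈K r 0≤r r≤t))
        in ( subst (λ b → ∣ γ τ ⊖ γ 0# ∣ ≤∞ τ ·∞ b) (sym ‖F‖≡L)
               (subst (λ l → ∣ γ τ ⊖ γ 0# ∣ ≤ l * L) (solve 1 (λ t → t :- :0 := t) refl τ)
                   (lipschitz F γ mean speed ≤-refl 0≤t ≤-refl))
           , subst (λ b → ∣ γ τ ⊖ γ 0# ⊖ τ ⊙ F (γ 0#) ∣ ≤∞ (½ * (τ * τ)) ·∞ b) (sym ‖DFF‖≡M)
               (subst (λ r → dev (γ 0#) (γ r) τ (F (γ 0#)) ≤ ½ * (τ * τ) * M) (R.+-identityˡ τ)
                 (second-order F γ mean 0≤M accel ≤-refl 0≤t (≤-reflexive (R.+-identityˡ τ))))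
           )
           , γ∈K 0# ≤-refl 0≤t , γ∈K τ 0≤t ≤-refl , γ h
           , mean-value⇒ℛ γ (half t) (mean-value-restrict F ≤-refl h≤t mean)
               (λ s 0≤s s≤h → γ∈K s 0≤s (≤-trans s≤h h≤t))
           -- The second half is the same curve started at time `h`; its end `h + h` is `τ`.
           , subst₂ (λ p q → (γ p , γ q , half t) ∈ ℛ[ F , K ]) (R.+-identityˡ h) (½x+½x τ)
               (mean-value⇒ℛ (λ s → γ (s + h)) (half t)
                 (mean-value-shift F {γ = γ} h
                     (mean-value-restrict F (≤-refl ⊞ 0≤h) (≤-reflexive (½x+½x τ)) mean))
                 (λ s 0≤s s≤h → γ∈K (s + h) (0≤s ⊞ 0≤h)
                     (subst (s + h ≤_) (½x+½x τ) (+-monoˡ-≤ h s≤h))))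
        where
        τ = value t
        h = ½ * τ
        0≤t = value-nonneg t
        0≤h = 0≤½ ⊠ 0≤t
        h≤t = ½*≤ 0≤t

        mean : MeanValue F γ 0# τ
        mean = integral-curve⇒mean-value {F = F} integral

      Γℛ⊆ℛ : Γ C¹ K ℛ[ F , K ] ⊆ ℛ[ F , K ]
      Γℛ⊆ℛ {x , y , t} (_ , _ , _ , u , (γ₁ , integral₁ , refl , γ₁h≡u , γ₁∈K) ,
          (γ₂ , integral₂ , γ₂0≡u , refl , γ₂∈K)) =
        subst₂ (λ p q → (p , q , t) ∈ ℛ[ F , K ]) (γ-left 0≤h) (trans (γ-right h≤t) (cong γ₂ t-h≡h))
          (mean-value⇒ℛ γ t (mean-value-join F {γ = γ}
              (mean-value-cong F (λ r _ r≤h → sym (γ-left r≤h))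
                  (integral-curve⇒mean-value {F = F} integral₁))
              (mean-value-cong F (λ r h≤r _ → sym (γ-right h≤r)) (mean-value-shift F {γ = γ₂} (- h)
                (subst₂ (MeanValue F γ₂) (sym (R.-‿inverseʳ h)) (sym t-h≡h)
                    (integral-curve⇒mean-value {F = F} integral₂)))))
            γ∈K)
        where
        τ = value t
        h = ½ * τ
        0≤t = value-nonneg t
        0≤h = 0≤½ ⊠ 0≤t
        h≤t = ½*≤ 0≤t

        t-h≡h : τ - h ≡ h
        t-h≡h = ≡-via (sym (½x+½x τ)) (solve 2 (λ t h → t :- h :+ (h :+ h) := h :+ t) refl τ h)

        -- The junction is assigned to `γ₁`; that `γ₂` has the same value there is seen through `u`.
        γ : ℝ → ℝ^ N
        γ s = branch (γ₁ s) (γ₂ (s - h)) (≤-total-strict s h)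

        γ-left : ∀ {s} → s ≤ h → γ s ≡ γ₁ s
        γ-left {s} s≤h = branch-inj₁ (≤-total-strict s h) λ h<s → <⇒≱ h<s s≤h

        γ-after : ∀ {s} → h < s → γ s ≡ γ₂ (s - h)
        γ-after {s} h<s = branch-inj₂ (≤-total-strict s h) (<⇒≱ h<s)

        γ-at : γ h ≡ γ₂ (h - h)
        γ-at = trans (γ-left ≤-refl)
            (trans γ₁h≡u (trans (sym γ₂0≡u) (cong γ₂ (sym (R.-‿inverseʳ h)))))

        γ-right : ∀ {s} → h ≤ s → γ s ≡ γ₂ (s - h)
        γ-right {s} h≤s = [ (λ s≤h → subst (λ r → γ r ≡ γ₂ (r - h)) (≤-antisym h≤s s≤h) γ-at) ,
            γ-after ]′ (≤-total-strict s h)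

        γ∈K : ∀ s → 0# ≤ s → s ≤ τ → γ s ∈ K
        γ∈K s 0≤s s≤t =
          [ (λ s≤h → subst (_∈ K) (sym (γ-left s≤h)) (γ₁∈K s 0≤s s≤h))
          , (λ h<s → subst (_∈ K) (sym (γ-after h<s))
              (γ₂∈K (s - h) (gap (<⇒≤ h<s)) (subst (s - h ≤_) t-h≡h (+-monoˡ-≤ (- h) s≤t))))
          ]′ (≤-total-strict s h)

      postfixpoint⊆ℛ : ∀ Z → Z ⊆ Γ C¹ K Z → Z ⊆ ℛ[ F , K ]
      postfixpoint⊆ℛ Z Z⊆ΓZ {x , y , t} z∈Z = [ degenerate , proper ]′ (≤-total-strict (value t) 0#)
        where
        x∈K = proj₁ (proj₂ (Z⊆ΓZ z∈Z))
        L = proj₁ (‖F‖-finite x∈K)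
        ‖F‖≡L = proj₁ (proj₂ (‖F‖-finite x∈K))
        0≤L = proj₁ (proj₂ (proj₂ (‖F‖-finite x∈K)))
        M = proj₁ (‖DF·F‖-finite x∈K)
        ‖DFF‖≡M = proj₁ (proj₂ (‖DF·F‖-finite x∈K))

        -- Durations in `X N` carry a proof of nonnegativity. The real index `τ`, tied to `t` by an
        -- equation, lets the bisection speak of `½ * τ` alone.
        S : ℝ^ N → ℝ^ N → ℝ → Set
        S x y τ = ∃ λ t → value t ≡ τ × (x , y , t) ∈ Z

        first-order : ∀ {x y τ} → S x y τ → ∣ y ⊖ x ∣ ≤ τ * L
        first-order {x} {y} (t , refl , z∈Z) = subst (λ b → ∣ y ⊖ x ∣ ≤∞ value t ·∞ b) ‖F‖≡L
            (proj₁ (proj₁ (Z⊆ΓZ z∈Z)))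

        bisectable : Bisectable F K L M S
        bisectable = record
          { start∈K   = λ { (t , refl , z∈Z) → proj₁ (proj₂ (Z⊆ΓZ z∈Z)) }
          ; first     = first-order
          ; second    = λ { {x} {y} (t , refl , z∈Z) →
              subst (λ b → dev x y (value t) (F x) ≤∞ (½ * (value t * value t)) ·∞ b) ‖DFF‖≡M
              (proj₂ (proj₁ (Z⊆ΓZ z∈Z))) }
          ; mid       = λ { (t , refl , z∈Z) → proj₁ (proj₂ (proj₂ (proj₂ (Z⊆ΓZ z∈Z)))) }
          ; leftHalf  = λ { (t , refl , z∈Z) →
              half t , refl , proj₁ (proj₂ (proj₂ (proj₂ (proj₂ (Z⊆ΓZ z∈Z))))) }
          ; rightHalf = λ { (t , refl , z∈Z) →
              half t , refl , proj₂ (proj₂ (proj₂ (proj₂ (proj₂ (Z⊆ΓZ z∈Z))))) }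
          }

        open Bisection {K = K} 0≤L bisectable (compact⇒closed K-compact)

        proper : 0# < value t → (x , y , t) ∈ ℛ[ F , K ]
        proper 0<t = subst₂ (λ p q → (p , q , t) ∈ ℛ[ F , K ]) (curve-0 σ) (curve-end σ)
          (mean-value⇒ℛ (curve σ) t (curve-mean-value σ) (λ s _ _ → curve∈K σ s))
          where
          σ = segment 0<t (t , refl , z∈Z)

        -- For duration 0 there is no positive segment to bisect; the first bound of `G` forces `y`
        -- to equal `x`, and a constant curve joins them.
        degenerate : value t ≤ 0# → (x , y , t) ∈ ℛ[ F , K ]
        degenerate t≤0 = subst (λ q → (x , q , t) ∈ ℛ[ F , K ]) x≡y
          (mean-value⇒ℛ (λ _ → x) t (mean-value-degenerate F {γ = λ _ → x} t≤0) (λ _ _ _ → x∈K))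
          where
          x≡y : x ≡ y
          x≡y = sym (dist-≤0⇒≡ y x (≤-trans (first-order (t , refl , z∈Z))
            (subst (value t * L ≤_) (R.zeroˡ L) (*-monoʳ-≤ 0≤L t≤0))))

      ℛ-greatest-fixpoint : IsGreatestFixpoint (Γ C¹ K) ℛ[ F , K ]
      ℛ-greatest-fixpoint = ((λ {z} → Γℛ⊆ℛ {z}) , (λ {z} → ℛ⊆Γℛ {z})) , λ Z (_ , Z⊆ΓZ) {z} →
          postfixpoint⊆ℛ Z (λ {z} → Z⊆ΓZ {z}) {z}

proposition6p4 : (em : ExcludedMiddle 0ℓ) (𝓕 : CompleteOrderedField) →
    let open Analysis em 𝓕 in
    (N : ℕ) (F : ℝ^ N → ℝ^ N) (C¹ : ContinuouslyDifferentiable F)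
    (K : Pred (ℝ^ N) 0ℓ) →
    Monotone (Γ C¹ K) ×
    (IsCompact K → IsGreatestFixpoint (Γ C¹ K) ℛ[ F , K ])
proposition6p4 em 𝓕 N F C¹ K =
  Γ-monotone em 𝓕 C¹ , λ K-compact → ℛ-greatest-fixpoint em 𝓕 C¹ K-compact
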